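{- (i) For every constant $C > e^2$, $g(r^{(\log C)/2}, r^{r/(2C)}) \le r$ for all sufficiently large $r$. (ii) For every constant $\varepsilon>0$, $g(2^{\varepsilon \log^2 r}, 2^{r^{1-\varepsilon}}) \le r$ for all sufficiently large $r$. (iii) There exists a positive constant $c$ such that $g(cr^2, r^{r^2/2}/e^{r^2}) \le r$ for all sufficiently large $r$.
   Context: All logarithms are base 2; non-integer arguments are understood to be rounded to integers (the paper omits floor and ceiling signs). For positive integers $m,n$, the grid graph $\Gamma_{m,n}$ is the graph on vertex set $[m]\times[n]$ in which distinct vertices $(i,j),(i',j')$ are adjacent iff $i=i'$ or $j=j'$. A rectangle is the induced subgraph on $\{(i,j),(i',j),(i,j'),(i',j')\}$ with $i<i'$, $j<j'$; in an edge coloring it is alternating if $\{(i,j),(i',j)\}$ and $\{(i,j'),(i',j')\}$ have the same color and $\{(i,j),(i,j')\}$ and $\{(i',j),(i',j')\}$ have the same color. $g(m,n)$ is the minimum integer $r$ for which there exists an edge coloring of $\Gamma_{m,n}$ with $r$ colors containing no alternating rectangle. -}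

module Defs where

open import Data.Fin.Base using (Fin) renaming (_<_ to _<ᶠ_)
open import Data.Fin.Properties using (<⇒≢)
open import Data.Integer.Base as ℤ using (ℤ; +_; -[1+_])
open import Data.Nat.Base as ℕ using (ℕ; zero; suc; _!)
open import Data.Nat.Properties using (_!≢0)
open import Data.Product using (_×_; _,_; ∃; ∃-syntax; proj₁; proj₂)
open import Data.Rational.Base as ℚ using (ℚ; 0ℚ; 1ℚ; ↥_; ↧ₙ_)
open import Data.Sum.Base using (_⊎_; inj₁; inj₂)
open import Function.Bundles using (_⇔_)
open import Relation.Binary.PropositionalEquality using (_≡_; _≢_; refl; cong)
open import Relation.Nullary using (¬_)
import Algebra.Definitions.RawSemiring as RawSemiringDefs

open RawSemiringDefs ℚ.+-*-rawSemiring using () renaming (_^_ to _^ℚ_)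

------------------------------------------------------------------------
-- Real numbers as two-sided Dedekind cuts.  The operations are given on
-- bare pairs of predicates; they preserve IsReal on the domains named
-- next to them, and are not meaningful outside these domains.

record Cut : Set₁ where
  field
    L U : ℚ → Set   -- L x q means q < x, U x q means x < q

open Cut public

record IsReal (x : Cut) : Set where
  field
    L-inhabited : ∃ (L x)
    U-inhabited : ∃ (U x)
    L-rounded   : ∀ q → L x q ⇔ (∃[ p ] (q ℚ.< p × L x p))
    U-rounded   : ∀ q → U x q ⇔ (∃[ p ] (p ℚ.< q × U x p))
    disjoint    : ∀ q → ¬ (L x q × U x q)
    located     : ∀ p q → p ℚ.< q → L x p ⊎ U x q

infix  4 _<ʳ_ _≤ʳ_
infixl 6 _-ʳ_
infixl 7 _*ʳ_ _/ʳ_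
infixr 8 _^ʳ_ _^ⁿ_

_<ʳ_ : Cut → Cut → Set
x <ʳ y = ∃[ q ] (U x q × L y q)

_≤ʳ_ : Cut → Cut → Set
x ≤ʳ y = ∀ q → L x q → L y q

fromℚ : ℚ → Cut
fromℚ p = record { L = λ q → q ℚ.< p ; U = λ q → p ℚ.< q }

fromℕ : ℕ → Cut
fromℕ n = fromℚ ((+ n) ℚ./ 1)

_-ʳ_ : Cut → Cut → Cut
x -ʳ y = record
  { L = λ q → ∃[ a ] ∃[ d ] (L x a × U y d × q ≡ a ℚ.- d)
  ; U = λ q → ∃[ b ] ∃[ c ] (U x b × L y c × q ≡ b ℚ.- c)
  }

-- Interval multiplication: if a < x < b and c < y < d, then x y lies
-- between the least and the greatest of a c, a d, b c, b d.
_*ʳ_ : Cut → Cut → Cut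
x *ʳ y = record
  { L = λ q → ∃[ a ] ∃[ b ] ∃[ c ] ∃[ d ] (L x a × U x b × L y c × U y d ×
          q ℚ.< a ℚ.* c × q ℚ.< a ℚ.* d × q ℚ.< b ℚ.* c × q ℚ.< b ℚ.* d)
  ; U = λ q → ∃[ a ] ∃[ b ] ∃[ c ] ∃[ d ] (L x a × U x b × L y c × U y d ×
          a ℚ.* c ℚ.< q × a ℚ.* d ℚ.< q × b ℚ.* c ℚ.< q × b ℚ.* d ℚ.< q)
  }

-- For y > 0.
inv : Cut → Cut
inv y = record
  { L = λ q → ∃[ u ] (U y u × q ℚ.* u ℚ.< 1ℚ)
  ; U = λ q → ∃[ l ] (L y l × 0ℚ ℚ.< l × 1ℚ ℚ.< q ℚ.* l)
  }

_/ʳ_ : Cut → Cut → Cut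
x /ʳ y = x *ʳ inv y

_^ⁿ_ : Cut → ℕ → Cut
x ^ⁿ zero    = fromℚ 1ℚ
x ^ⁿ (suc k) = x *ʳ (x ^ⁿ k)

-- e is the supremum of the partial sums of Σ 1/k!.
expSum : ℕ → ℚ
expSum zero    = 1ℚ
expSum (suc n) = expSum n ℚ.+ ((+ 1) ℚ./ (suc n !)) {{suc n !≢0}}

e : Cut
e = record
  { L = λ q → ∃[ n ] (q ℚ.< expSum n)
  ; U = λ q → ∃[ b ] (b ℚ.< q × (∀ n → expSum n ℚ.≤ b))
  }

posPart : ℤ → ℕ
posPart (+ n)    = n
posPart -[1+ _ ] = 0

negPart : ℤ → ℕ
negPart z = posPart (ℤ.- z)

pow : ℕ → ℕ → ℚ
pow b k = ((+ b) ℚ./ 1) ^ℚ k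

-- For b ≥ 1 and p = a / d in lowest terms, q < b ^ p iff q ≤ 0 or
-- q ^ d < b ^ a; the negative part of a is moved to the other side.
_<[_^_] : ℚ → ℕ → ℚ → Set
q <[ b ^ p ] = q ℚ.≤ 0ℚ ⊎
  (q ^ℚ (↧ₙ p)) ℚ.* pow b (negPart (↥ p)) ℚ.< pow b (posPart (↥ p))

[_^_]<_ : ℕ → ℚ → ℚ → Set
[ b ^ p ]< q = 0ℚ ℚ.< q ×
  pow b (posPart (↥ p)) ℚ.< (q ^ℚ (↧ₙ p)) ℚ.* pow b (negPart (↥ p))

-- For b ≥ 1: the supremum of b ^ p over rational p < y, which is also the
-- infimum of b ^ p over rational p > y.
_^ʳ_ : ℕ → Cut → Cut
b ^ʳ y = record
  { L = λ q → ∃[ p ] (L y p × q <[ b ^ p ])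
  ; U = λ q → ∃[ p ] (U y p × [ b ^ p ]< q)
  }

-- Base-2 logarithm of x > 0: p < log x iff 2 ^ p < x.
log : Cut → Cut
log x = record
  { L = λ p → ∃[ q ] ([ 2 ^ p ]< q × L x q)
  ; U = λ p → ∃[ q ] (q <[ 2 ^ p ] × U x q)
  }

IsFloor : ℕ → Cut → Set
IsFloor m x = fromℕ m ≤ʳ x × x <ʳ fromℕ (suc m)

------------------------------------------------------------------------
-- Grid graphs

Vertex : ℕ → ℕ → Set
Vertex m n = Fin m × Fin n

Adj : ∀ {m n} → Vertex m n → Vertex m n → Set
Adj u v = u ≢ v × (proj₁ u ≡ proj₁ v ⊎ proj₂ u ≡ proj₂ v)

-- The law makes the color a function of the unordered pair {u , v} alone,
-- independent also of the proof of adjacency.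
record EdgeColoring (m n r : ℕ) : Set where
  field
    color     : (u v : Vertex m n) → Adj u v → Fin r
    color-sym : ∀ u v (p : Adj u v) (q : Adj v u) → color u v p ≡ color v u q

open EdgeColoring public

edge₁ : ∀ {m n} {i i′ : Fin m} (j : Fin n) → i <ᶠ i′ → Adj (i , j) (i′ , j)
edge₁ j i<i′ = (λ eq → <⇒≢ i<i′ (cong proj₁ eq)) , inj₂ refl

edge₂ : ∀ {m n} (i : Fin m) {j j′ : Fin n} → j <ᶠ j′ → Adj (i , j) (i , j′)
edge₂ i j<j′ = (λ eq → <⇒≢ j<j′ (cong proj₂ eq)) , inj₁ refl

Alternating : ∀ {m n r} → EdgeColoring m n r →
              {i i′ : Fin m} {j j′ : Fin n} → i <ᶠ i′ → j <ᶠ j′ → Set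
Alternating c {i} {i′} {j} {j′} i<i′ j<j′ =
  color c (i , j) (i′ , j) (edge₁ j i<i′) ≡ color c (i , j′) (i′ , j′) (edge₁ j′ i<i′)
  ×
  color c (i , j) (i , j′) (edge₂ i j<j′) ≡ color c (i′ , j) (i′ , j′) (edge₂ i′ j<j′)

Colorable : ℕ → ℕ → ℕ → Set
Colorable m n r =
  ∃ λ (c : EdgeColoring m n r) →
    ∀ {i i′ j j′} (i<i′ : i <ᶠ i′) (j<j′ : j <ᶠ j′) → ¬ Alternating c i<i′ j<j′

g⟨_,_⟩≡_ : ℕ → ℕ → ℕ → Set
g⟨ m , n ⟩≡ k = Colorable m n k × (∀ k′ → Colorable m n k′ → k ℕ.≤ k′)

-- g (x , y) ≤ r, with the real arguments x and y rounded down.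
g⌊_,_⌋≤_ : Cut → Cut → ℕ → Set
g⌊ x , y ⌋≤ r =
  ∀ m n → IsFloor m x → IsFloor n y → ∃[ k ] ((g⟨ m , n ⟩≡ k) × k ℕ.≤ r)

ForLarge : (ℕ → Set) → Set
ForLarge P = ∃[ R ] (∀ r → R ℕ.≤ r → P r)

{-# OPTIONS --safe #-}

-- A coloring of the m × n grid without alternating rectangle amounts to N
-- colorings of the edges of K_V, where {N, V} = {m, n}, such that for any two of
-- them the graph of the edges on which they agree is r-colorable.  Such families
-- are chosen greedily: N - 1 times the number of colorings in conflict with a
-- given one has to be less than the number of all colorings.
--
-- For (i) and (ii) the vertices are the bit vectors of length t, and a word of
-- length t over [r] colors a pair of bit vectors by the letter at a position
-- where they differ.  If two words agree on at most l ≤ log r positions, then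
-- restricting the bit vectors to these positions is a proper coloring of the
-- agreement graph with 2^l ≤ r colors.  For (iii) the edges are colored
-- arbitrarily; a graph that is not r-colorable contains a nonempty vertex set W
-- inducing minimum degree at least r, hence at least |W| r / 2 edges.  Both kinds
-- of conflicts are counted with a Chernoff bound.
module Submission where

open import Defs
open import Algebra.Bundles using (CommutativeMonoid)
import Algebra.Definitions.RawSemiring as RawSemiringDefs
open import Data.Bool.Base using (Bool; true; false; _∧_; not; T)
open import Data.Bool.Properties using (T?)
open import Data.Fin.Base using (Fin; zero; suc; inject≤; toℕ; finToFun; funToFin; combine) renaming (_<_ to _<ᶠ_)
import Data.Fin.Properties as Fin
open import Data.Integer.Base as ℤ using (-[1+_])
import Data.Integer.Properties as ℤ
open import Data.List.Base as List using (List; []; _∷_; map; length; allFin; cartesianProductWith)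
open import Data.List.Membership.Propositional using (_∈_; lose)
open import Data.List.Membership.Propositional.Properties using (∈-allFin; ∈-cartesianProductWith⁺)
open import Data.List.Properties using (map-tabulate; map-++; map-∘; length-tabulate)
open import Data.List.Relation.Unary.Any as Any using (any?; here; there)
open import Data.Nat.Base
import Data.Nat.Coprimality as Coprimality
open import Data.Nat.DivMod using (m≡m%n+[m/n]*n; m%n<n; m/n*n≤m)
open import Data.Nat.ListAction using (sum; product)
open import Data.Nat.ListAction.Properties using (sum-++)
open import Data.Nat.Properties
open import Data.Nat.Tactic.RingSolver using (solve-∀)
open import Data.Product.Base using (Σ; ∃; ∃-syntax; _×_; _,_; proj₁; proj₂)
open import Data.Rational.Base as ℚ using (ℚ; 0ℚ; 1ℚ; mkℚ; fromℚᵘ; *<*; *≤*; ↥_; ↧ₙ_)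
import Data.Rational.Properties as ℚ
open import Data.Rational.Unnormalised.Base using (mkℚᵘ; *≡*)
open import Data.Sum.Base using (_⊎_; inj₁; inj₂)
open import Data.Vec.Base using (Vec; []; _∷_; lookup; tabulate; _[_]≔_; replicate)
open import Data.Vec.Properties using (lookup∘tabulate; lookup∘update; lookup∘update′; lookup-replicate)
open import Function.Base using (_∘_; id)
open import Function.Bundles using (module Equivalence; mk⇔)
open import Relation.Binary.Definitions using (Tri; tri<; tri≈; tri>)
open import Relation.Binary.PropositionalEquality
open import Relation.Nullary using (¬_; Dec)
open import Relation.Nullary.Decidable
  using (does; yes; no; ¬?; decidable-stable; dec-true; map′; toWitness; _×-dec_; _⊎-dec_; _→-dec_)
open import Relation.Nullary.Negation using (contradiction)
open import Relation.Unary using (Decidable)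
open import Algebra.Properties.CommutativeSemigroup *-commutativeSemigroup
  using () renaming (interchange to *-interchange; x∙yz≈y∙xz to x*yz≡y*xz; xy∙z≈xz∙y to xy*z≡xz*y)
open import Algebra.Properties.CommutativeSemigroup +-commutativeSemigroup
  using () renaming (interchange to +-interchange)
open import Algebra.Properties.CommutativeSemigroup
  (CommutativeMonoid.commutativeSemigroup ℚ.*-1-commutativeMonoid)
  using () renaming (interchange to ℚ-interchange; xy∙z≈xz∙y to ℚ-swap)

-- Finite sums and counting

-- Real numbers enter only through rational witnesses of their cuts: `L (b ^ʳ y) q` unfolds to a
-- rational p = a / d below y with, when p and q are positive, q ^ d < b ^ a. Each estimate thus
-- becomes an inequality between natural numbers raised to a common power, and e is replaced by
-- rational bounds on both sides. The Chernoff bound works with (1 + s/b) ^ b ≤ 4 ^ s instead of e ^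
-- s. With e itself the count in (i) would succeed for C > e²/4; with 4 it succeeds for C > 4, and C
-- > e² > 6 is given. In (iii) the factor e ^ (- r²) enters as (2/5) ^ (r²) and has to pay for the 2
-- ^ m vertex sets W and for the losses of the Chernoff bound. A bound on g also asserts that the
-- minimum is attained, which constructively calls for a decision procedure for `Colorable`.

private variable
  𝒜 ℬ 𝒞 : Set

∑ ∏ : List 𝒜 → (𝒜 → ℕ) → ℕ
∑ xs f = sum (map f xs)
∏ xs f = product (map f xs)

∑-cong : ∀ (xs : List 𝒜) {f g} → (∀ x → f x ≡ g x) → ∑ xs f ≡ ∑ xs g
∑-cong []       f≡g = refl
∑-cong (x ∷ xs) f≡g = cong₂ _+_ (f≡g x) (∑-cong xs f≡g)

∑-mono : ∀ (xs : List 𝒜) {f g} → (∀ x → f x ≤ g x) → ∑ xs f ≤ ∑ xs g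
∑-mono []       f≤g = z≤n
∑-mono (x ∷ xs) f≤g = +-mono-≤ (f≤g x) (∑-mono xs f≤g)

∑-distrib-+ : ∀ (xs : List 𝒜) f g → ∑ xs (λ x → f x + g x) ≡ ∑ xs f + ∑ xs g
∑-distrib-+ []       f g = refl
∑-distrib-+ (x ∷ xs) f g = trans (cong (f x + g x +_) (∑-distrib-+ xs f g))
                                 (+-interchange (f x) (g x) _ _)

∑-const : ∀ (xs : List 𝒜) c → ∑ xs (λ _ → c) ≡ length xs * c
∑-const []       c = refl
∑-const (_ ∷ xs) c = cong (c +_) (∑-const xs c)

*-distribˡ-∑ : ∀ (xs : List 𝒜) c f → c * ∑ xs f ≡ ∑ xs (λ x → c * f x)
*-distribˡ-∑ []       c f = *-zeroʳ c
*-distribˡ-∑ (x ∷ xs) c f = trans (*-distribˡ-+ c (f x) _) (cong (c * f x +_) (*-distribˡ-∑ xs c f))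

*-distribʳ-∑ : ∀ (xs : List 𝒜) c f → ∑ xs f * c ≡ ∑ xs (λ x → f x * c)
*-distribʳ-∑ xs c f = trans (*-comm (∑ xs f) c)
  (trans (*-distribˡ-∑ xs c f) (∑-cong xs (λ x → *-comm c (f x))))

∑-comm : ∀ (xs : List 𝒜) (ys : List ℬ) (f : 𝒜 → ℬ → ℕ) →
  ∑ xs (λ x → ∑ ys (f x)) ≡ ∑ ys (λ y → ∑ xs (λ x → f x y))
∑-comm []       ys f = sym (trans (∑-const ys 0) (*-zeroʳ (length ys)))
∑-comm (x ∷ xs) ys f = trans (cong (∑ ys (f x) +_) (∑-comm xs ys f))
                             (sym (∑-distrib-+ ys (f x) _))

-- First-moment principle: a natural number that is not 0 contributes at least 1.
∑<length⇒∃0 : ∀ (xs : List 𝒜) f → ∑ xs f < length xs → ∃ λ x → f x ≡ 0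
∑<length⇒∃0 (x ∷ xs) f lt with f x in eq
... | zero  = x , eq
... | suc k = ∑<length⇒∃0 xs f (≤-trans (s≤s (m≤n+m _ k)) (s<s⁻¹ lt))

∑≡0⇒≡0 : ∀ {xs : List 𝒜} f {x} → ∑ xs f ≡ 0 → x ∈ xs → f x ≡ 0
∑≡0⇒≡0 {xs = x ∷ xs} f eq (here refl)  = m+n≡0⇒m≡0 (f x) eq
∑≡0⇒≡0 {xs = x ∷ xs} f eq (there x∈xs) = ∑≡0⇒≡0 f (m+n≡0⇒n≡0 (f x) eq) x∈xs

∑-++ : ∀ (xs ys : List 𝒜) f → ∑ (xs List.++ ys) f ≡ ∑ xs f + ∑ ys f
∑-++ xs ys f = trans (cong sum (map-++ f xs ys)) (sum-++ (map f xs) (map f ys))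

∑-map : ∀ (f : 𝒜 → ℬ) (xs : List 𝒜) g → ∑ (map f xs) g ≡ ∑ xs (g ∘ f)
∑-map f xs g = cong sum (sym (map-∘ xs))

∑-cartesianProductWith : ∀ (h : 𝒜 → ℬ → 𝒞) xs ys f →
  ∑ (cartesianProductWith h xs ys) f ≡ ∑ xs (λ x → ∑ ys (λ y → f (h x y)))
∑-cartesianProductWith h []       ys f = refl
∑-cartesianProductWith h (x ∷ xs) ys f = trans (∑-++ (map (h x) ys) _ f)
  (cong₂ _+_ (∑-map (h x) ys f) (∑-cartesianProductWith h xs ys f))

map-allFin-suc : ∀ {n} (f : Fin (suc n) → 𝒜) → map f (allFin (suc n)) ≡ f zero ∷ map (f ∘ suc) (allFin n)
map-allFin-suc f = cong (f zero ∷_) (trans (map-tabulate suc f) (sym (map-tabulate id (f ∘ suc))))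

∑-allFin-suc : ∀ {n} (f : Fin (suc n) → ℕ) → ∑ (allFin (suc n)) f ≡ f zero + ∑ (allFin n) (f ∘ suc)
∑-allFin-suc = cong sum ∘ map-allFin-suc

∏-allFin-suc : ∀ {n} (f : Fin (suc n) → ℕ) → ∏ (allFin (suc n)) f ≡ f zero * ∏ (allFin n) (f ∘ suc)
∏-allFin-suc = cong product ∘ map-allFin-suc

length-allFin : ∀ n → length (allFin n) ≡ n
length-allFin n = length-tabulate id

∏-cong : ∀ (xs : List 𝒜) {f g} → (∀ x → f x ≡ g x) → ∏ xs f ≡ ∏ xs g
∏-cong []       f≡g = refl
∏-cong (x ∷ xs) f≡g = cong₂ _*_ (f≡g x) (∏-cong xs f≡g)

∏-distrib-* : ∀ (xs : List 𝒜) f g → ∏ xs (λ x → f x * g x) ≡ ∏ xs f * ∏ xs g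
∏-distrib-* []       f g = refl
∏-distrib-* (x ∷ xs) f g = trans (cong (f x * g x *_) (∏-distrib-* xs f g))
                                 (*-interchange (f x) (g x) _ _)

∏-^ : ∀ (xs : List 𝒜) c f → ∏ xs (λ x → c ^ f x) ≡ c ^ ∑ xs f
∏-^ []       c f = refl
∏-^ (x ∷ xs) c f = trans (cong (c ^ f x *_) (∏-^ xs c f)) (sym (^-distribˡ-+-* c (f x) _))

∏-const : ∀ (xs : List 𝒜) c → ∏ xs (λ _ → c) ≡ c ^ length xs
∏-const []       c = refl
∏-const (_ ∷ xs) c = cong (c *_) (∏-const xs c)

words : List 𝒜 → ∀ t → List (Vec 𝒜 t)
words xs zero    = [] ∷ []
words xs (suc t) = cartesianProductWith _∷_ xs (words xs t)

length-words : ∀ (xs : List 𝒜) t → length (words xs t) ≡ length xs ^ t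
length-words xs t = trans (sym (trans (∑-const (words xs t) 1) (*-identityʳ _))) (count xs t)
  where
  count : ∀ (xs : List 𝒜) t → ∑ (words xs t) (λ _ → 1) ≡ length xs ^ t
  count xs zero    = refl
  count xs (suc t) = trans (∑-cartesianProductWith _∷_ xs (words xs t) _)
    (trans (∑-cong xs (λ _ → count xs t)) (∑-const xs _))

∈-words : ∀ {xs : List 𝒜} → (∀ x → x ∈ xs) → ∀ {t} (w : Vec 𝒜 t) → w ∈ words xs t
∈-words all []      = here refl
∈-words all (x ∷ w) = ∈-cartesianProductWith⁺ _∷_ (all x) (∈-words all w)

-- Independence of the letters of a uniform random word, without dividing by the number of words.
∑-words-∏ : ∀ (xs : List 𝒜) {t} (g : Fin t → 𝒜 → ℕ) (b : Fin t → ℕ) →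
  (∀ c → ∑ xs (g c) ≤ b c) →
  ∑ (words xs t) (λ w → ∏ (allFin t) (λ c → g c (lookup w c))) ≤ ∏ (allFin t) b
∑-words-∏ xs {zero}  g b g≤b = ≤-refl
∑-words-∏ xs {suc t} g b g≤b = begin
  ∑ (words xs (suc t)) (λ w → ∏ (allFin (suc t)) (λ c → g c (lookup w c)))
    ≡⟨ ∑-cartesianProductWith _∷_ xs (words xs t) _ ⟩
  ∑ xs (λ x → ∑ (words xs t) (λ w → ∏ (allFin (suc t)) (λ c → g c (lookup (x ∷ w) c))))
    ≡⟨ ∑-cong xs (λ x → ∑-cong (words xs t) (λ w → ∏-allFin-suc (λ c → g c (lookup (x ∷ w) c)))) ⟩
  ∑ xs (λ x → ∑ (words xs t) (λ w → g zero x * rest w))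
    ≡⟨ ∑-cong xs (λ x → sym (*-distribˡ-∑ (words xs t) (g zero x) rest)) ⟩
  ∑ xs (λ x → g zero x * ∑ (words xs t) rest)
    ≡⟨ sym (*-distribʳ-∑ xs _ (g zero)) ⟩
  ∑ xs (g zero) * ∑ (words xs t) rest
    ≤⟨ *-mono-≤ (g≤b zero) (∑-words-∏ xs (g ∘ suc) (b ∘ suc) (g≤b ∘ suc)) ⟩
  b zero * ∏ (allFin t) (b ∘ suc)
    ≡⟨ sym (∏-allFin-suc b) ⟩
  ∏ (allFin (suc t)) b ∎
  where
  open ≤-Reasoning
  rest : Vec _ t → ℕ
  rest w = ∏ (allFin t) (λ c → g (suc c) (lookup w c))

𝟙 : Bool → ℕ
𝟙 true  = 1
𝟙 false = 0

∑-𝟙-≟ : ∀ {n} (x : Fin n) → ∑ (allFin n) (λ y → 𝟙 (does (y Fin.≟ x))) ≡ 1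
∑-𝟙-≟ {suc n} x = trans (∑-allFin-suc (λ y → 𝟙 (does (y Fin.≟ x)))) (at x)
  where
  at : ∀ x → 𝟙 (does (zero Fin.≟ x)) + ∑ (allFin n) (λ y → 𝟙 (does (suc y Fin.≟ x))) ≡ 1
  at zero    = cong suc (trans (∑-const (allFin n) 0) (*-zeroʳ (length (allFin n))))
  at (suc x) = ∑-𝟙-≟ x

-- Bernoulli: (1 - 1/(x+1))^b ≥ 1 - b/(x+1), cleared of denominators.
bernoulli : ∀ x b → suc x ^ b * suc x ≤ x ^ b * suc x + b * suc x ^ b
bernoulli x zero    = m≤m+n _ _
bernoulli x (suc b) = begin
  suc x * p * suc x                           ≡⟨ xy*z≡xz*y (suc x) p (suc x) ⟩
  suc x * suc x * p                           ≡⟨ trans (*-assoc (suc x) (suc x) p) (cong (suc x *_) (*-comm (suc x) p)) ⟩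
  suc x * (p * suc x)                         ≡⟨⟩
  p * suc x + x * (p * suc x)                 ≤⟨ +-monoʳ-≤ (p * suc x) (*-monoʳ-≤ x (bernoulli x b)) ⟩
  p * suc x + x * (x ^ b * suc x + b * p)     ≡⟨ cong (p * suc x +_) (*-distribˡ-+ x _ (b * p)) ⟩
  p * suc x + (x * (x ^ b * suc x) + x * (b * p))
    ≤⟨ +-monoʳ-≤ (p * suc x) (+-monoʳ-≤ (x * (x ^ b * suc x)) (m≤n+m _ (b * p))) ⟩
  p * suc x + (x * (x ^ b * suc x) + suc x * (b * p))
    ≡⟨ cong₂ _+_ (*-comm p (suc x)) (cong₂ _+_ (sym (*-assoc x (x ^ b) (suc x))) (x*yz≡y*xz (suc x) b p)) ⟩
  suc x * p + (x * x ^ b * suc x + b * (suc x * p))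
    ≡⟨ trans (sym (+-assoc (suc x * p) _ _)) (trans (cong (_+ b * (suc x * p)) (+-comm (suc x * p) _)) (+-assoc (x * x ^ b * suc x) (suc x * p) _)) ⟩
  x * x ^ b * suc x + (suc x * p + b * (suc x * p)) ∎
  where
  open ≤-Reasoning
  p = suc x ^ b

-- Here b/(x+1) ≤ 1/2, so Bernoulli's lower bound is at least 1/2.
[1+x]^b≤2x^b : ∀ x b → b + b ≤ suc x → suc x ^ b ≤ 2 * x ^ b
[1+x]^b≤2x^b x b 2b≤x = *-cancelʳ-≤ _ _ (suc x) (+-cancelʳ-≤ (p * suc x) _ _ (begin
  p * suc x + p * suc x                         ≤⟨ +-mono-≤ (bernoulli x b) (bernoulli x b) ⟩
  (q * suc x + b * p) + (q * suc x + b * p)     ≡⟨ +-interchange (q * suc x) (b * p) _ _ ⟩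
  (q * suc x + q * suc x) + (b * p + b * p)     ≡⟨ cong₂ _+_ (sym (*-distribʳ-+ (suc x) q q)) (sym (*-distribʳ-+ p b b)) ⟩
  (q + q) * suc x + (b + b) * p                 ≤⟨ +-monoʳ-≤ ((q + q) * suc x) (*-monoˡ-≤ p 2b≤x) ⟩
  (q + q) * suc x + suc x * p                   ≡⟨ cong₂ _+_ (cong (λ z → (q + z) * suc x) (sym (+-identityʳ q))) (*-comm (suc x) p) ⟩
  2 * q * suc x + p * suc x                     ∎))
  where
  open ≤-Reasoning
  p = suc x ^ b
  q = x ^ b

-- Both halves of the exponent fall under the previous bound; 2 · 2 = 4 is the substitute for e.
[1+x]^b≤4x^b : ∀ x b → b ≤ x → suc x ^ b ≤ 4 * x ^ b
[1+x]^b≤4x^b x b b≤x = begin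
  suc x ^ b                                 ≡⟨ cong (suc x ^_) (sym (⌊n/2⌋+⌈n/2⌉≡n b)) ⟩
  suc x ^ (⌊ b /2⌋ + ⌈ b /2⌉)               ≡⟨ ^-distribˡ-+-* (suc x) ⌊ b /2⌋ ⌈ b /2⌉ ⟩
  suc x ^ ⌊ b /2⌋ * suc x ^ ⌈ b /2⌉         ≤⟨ *-mono-≤ ([1+x]^b≤2x^b x ⌊ b /2⌋ (≤-trans (+-monoʳ-≤ ⌊ b /2⌋ (⌊n/2⌋≤⌈n/2⌉ b)) (≤-trans (≤-reflexive (⌊n/2⌋+⌈n/2⌉≡n b)) (m≤n⇒m≤1+n b≤x))))
                                                        ([1+x]^b≤2x^b x ⌈ b /2⌉ (≤-trans (+-monoʳ-≤ ⌈ b /2⌉ (⌊n/2⌋≤⌊1+n/2⌋′ b)) (≤-trans (≤-reflexive (⌊n/2⌋+⌈n/2⌉≡n (suc b))) (s≤s b≤x)))) ⟩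
  2 * x ^ ⌊ b /2⌋ * (2 * x ^ ⌈ b /2⌉)       ≡⟨ *-interchange 2 (x ^ ⌊ b /2⌋) 2 (x ^ ⌈ b /2⌉) ⟩
  4 * (x ^ ⌊ b /2⌋ * x ^ ⌈ b /2⌉)           ≡⟨ cong (4 *_) (sym (^-distribˡ-+-* x ⌊ b /2⌋ ⌈ b /2⌉)) ⟩
  4 * x ^ (⌊ b /2⌋ + ⌈ b /2⌉)               ≡⟨ cong (λ n → 4 * x ^ n) (⌊n/2⌋+⌈n/2⌉≡n b) ⟩
  4 * x ^ b                                 ∎
  where
  open ≤-Reasoning
  ⌊n/2⌋≤⌊1+n/2⌋′ : ∀ n → ⌈ n /2⌉ ≤ ⌈ suc n /2⌉
  ⌊n/2⌋≤⌊1+n/2⌋′ n = ⌊n/2⌋-mono (s≤s (n≤1+n n))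

-- The base grows by one unit at a time, each costing a factor 4; c never exceeds the growing base.
[b+s]^b≤4^s*b^b : ∀ b s {c} → c ≤ b → (b + s) ^ c ≤ 4 ^ s * b ^ c
[b+s]^b≤4^s*b^b b zero    {c} c≤b = ≤-reflexive (trans (cong (_^ c) (+-identityʳ b)) (sym (+-identityʳ _)))
[b+s]^b≤4^s*b^b b (suc s) {c} c≤b = begin
  (b + suc s) ^ c        ≡⟨ cong (_^ c) (+-suc b s) ⟩
  suc (b + s) ^ c        ≤⟨ [1+x]^b≤4x^b (b + s) c (≤-trans c≤b (m≤m+n b s)) ⟩
  4 * (b + s) ^ c        ≤⟨ *-monoʳ-≤ 4 ([b+s]^b≤4^s*b^b b s c≤b) ⟩
  4 * (4 ^ s * b ^ c)    ≡⟨ sym (*-assoc 4 (4 ^ s) _) ⟩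
  4 ^ suc s * b ^ c      ∎
  where open ≤-Reasoning

-- Greedy selection

abstract
  -- A newly chosen object is put at index zero, so it is always the first argument of `bad`, the
  -- one over which `few` sums.
  greedy : ∀ (xs : List 𝒞) (bad : 𝒞 → 𝒞 → ℕ) n → 0 < length xs →
    (∀ χ → n * ∑ xs (λ ψ → bad ψ χ) < length xs) →
    Σ (Fin (suc n) → 𝒞) (λ f → ∀ {i j} → i <ᶠ j → bad (f i) (f j) ≡ 0)
  greedy {𝒞 = 𝒞} xs bad n 0<N few = go (suc n) ≤-refl
    where
    Good : ∀ k → (Fin k → 𝒞) → Set
    Good k f = ∀ {i j} → i <ᶠ j → bad (f i) (f j) ≡ 0

    extend : ∀ {k} → (Fin k → 𝒞) → 𝒞 → Fin (suc k) → 𝒞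
    extend f x zero    = x
    extend f x (suc i) = f i

    conflicts : ∀ {k} → (Fin k → 𝒞) → ℕ
    conflicts {k} f = ∑ xs (λ ψ → ∑ (allFin k) (λ i → bad ψ (f i)))

    -- The summand k collects one unit from each strict inequality `few`. It keeps the total strict,
    -- except for k = 0, where `0 < length xs` takes over.
    n*conflicts : ∀ {k} (f : Fin k → 𝒞) → k + n * conflicts f ≤ k * length xs
    n*conflicts {k} f = begin
      k + n * conflicts f
        ≡⟨ cong₂ _+_ (trans (sym (*-identityʳ k)) (trans (cong (_* 1) (sym (length-allFin k))) (sym (∑-const (allFin k) 1)))) (trans (cong (n *_) (∑-comm xs (allFin k) _)) (*-distribˡ-∑ (allFin k) n _)) ⟩
      ∑ (allFin k) (λ _ → 1) + ∑ (allFin k) (λ i → n * ∑ xs (λ ψ → bad ψ (f i)))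
        ≡⟨ sym (∑-distrib-+ (allFin k) (λ _ → 1) _) ⟩
      ∑ (allFin k) (λ i → 1 + n * ∑ xs (λ ψ → bad ψ (f i)))
        ≤⟨ ∑-mono (allFin k) (λ i → few (f i)) ⟩
      ∑ (allFin k) (λ _ → length xs)
        ≡⟨ ∑-const (allFin k) (length xs) ⟩
      length (allFin k) * length xs
        ≡⟨ cong (_* length xs) (length-allFin k) ⟩
      k * length xs ∎
      where open ≤-Reasoning

    conflicts< : ∀ k (f : Fin k → 𝒞) → k ≤ n → conflicts f < length xs
    conflicts< zero    f _   = subst (_< length xs) (sym (trans (∑-const xs 0) (*-zeroʳ (length xs)))) 0<N
    conflicts< (suc k) f k<n with conflicts f <? length xs
    ... | yes p = p
    ... | no ¬p = contradiction
      (≤-trans (n*conflicts f) (≤-trans (*-monoˡ-≤ (length xs) k<n) (*-monoʳ-≤ n (≮⇒≥ ¬p))))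
      (<⇒≱ (m<n+m _ z<s))

    go : ∀ k → k ≤ suc n → Σ (Fin k → 𝒞) (Good k)
    go zero    _   = (λ ()) , λ {i} → contradiction i λ ()
    go (suc k) k<n with go k (<⇒≤ k<n)
    ... | f , good with ∑<length⇒∃0 xs _ (conflicts< k f (s≤s⁻¹ k<n))
    ... | x , x≡0 = extend f x , good′
      where
      good′ : Good (suc k) (extend f x)
      good′ {zero}  {suc j} _   = ∑≡0⇒≡0 (λ i → bad x (f i)) x≡0 (∈-allFin j)
      good′ {suc i} {suc j} i<j = good (s<s⁻¹ i<j)

-- Random matrices and the Chernoff bound

Matrix : ℕ → ℕ → ℕ → Set
Matrix r m n = Vec (Vec (Fin r) n) m

infixl 20 _⟨_,_⟩
_⟨_,_⟩ : ∀ {r m n} → Matrix r m n → Fin m → Fin n → Fin r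
ψ ⟨ i , j ⟩ = lookup (lookup ψ i) j

-- The sample space of both constructions: words are the matrices with one row, edge colorings of
-- K_m are square matrices read above the diagonal.
matrices : ∀ r m n → List (Matrix r m n)
matrices r m n = words (words (allFin r) n) m

length-matrices : ∀ r m n → length (matrices r m n) ≡ (r ^ n) ^ m
length-matrices r m n = trans (length-words (words (allFin r) n) m)
  (cong (_^ m) (trans (length-words (allFin r) n) (cong (_^ n) (length-allFin r))))

∑² ∏² : ∀ m n → (Fin m → Fin n → ℕ) → ℕ
∑² m n f = ∑ (allFin m) (λ i → ∑ (allFin n) (f i))
∏² m n f = ∏ (allFin m) (λ i → ∏ (allFin n) (f i))

∑²-cong : ∀ {m n f g} → (∀ i j → f i j ≡ g i j) → ∑² m n f ≡ ∑² m n g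
∑²-cong {m} {n} f≡g = ∑-cong (allFin m) (λ i → ∑-cong (allFin n) (f≡g i))

∑²-mono : ∀ {m n f g} → (∀ i j → f i j ≤ g i j) → ∑² m n f ≤ ∑² m n g
∑²-mono {m} {n} f≤g = ∑-mono (allFin m) (λ i → ∑-mono (allFin n) (f≤g i))

∑²-distrib-+ : ∀ {m n} f g → ∑² m n (λ i j → f i j + g i j) ≡ ∑² m n f + ∑² m n g
∑²-distrib-+ {m} {n} f g = trans (∑-cong (allFin m) (λ i → ∑-distrib-+ (allFin n) (f i) (g i)))
                                 (∑-distrib-+ (allFin m) _ _)

∏²-distrib-* : ∀ {m n} f g → ∏² m n (λ i j → f i j * g i j) ≡ ∏² m n f * ∏² m n g
∏²-distrib-* {m} {n} f g = trans (∏-cong (allFin m) (λ i → ∏-distrib-* (allFin n) (f i) (g i)))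
                                 (∏-distrib-* (allFin m) _ _)

∏²-^ : ∀ {m n} c f → ∏² m n (λ i j → c ^ f i j) ≡ c ^ ∑² m n f
∏²-^ {m} {n} c f = trans (∏-cong (allFin m) (λ i → ∏-^ (allFin n) c (f i)))
                         (∏-^ (allFin m) c _)

∑-matrices-∏² : ∀ r m n (g : Fin m → Fin n → Fin r → ℕ) (b : Fin m → Fin n → ℕ) →
  (∀ i j → ∑ (allFin r) (g i j) ≤ b i j) →
  ∑ (matrices r m n) (λ ψ → ∏² m n (λ i j → g i j (ψ ⟨ i , j ⟩))) ≤ ∏² m n b
∑-matrices-∏² r m n g b g≤b =
  ∑-words-∏ (words (allFin r) n) (λ i w → ∏ (allFin n) (λ j → g i j (lookup w j))) _
    (λ i → ∑-words-∏ (allFin r) (g i) (b i) (g≤b i))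

module _ {r m n} (F : Fin m → Fin n → Bool) (ψ χ : Matrix r m n) where
  agrees differs : Fin m → Fin n → ℕ
  agrees  i j = 𝟙 (F i j ∧ does (ψ ⟨ i , j ⟩ Fin.≟ χ ⟨ i , j ⟩))
  differs i j = 𝟙 (F i j ∧ not (does (ψ ⟨ i , j ⟩ Fin.≟ χ ⟨ i , j ⟩)))

  agreement : ℕ
  agreement = ∑² m n agrees

size : ∀ {m n} → (Fin m → Fin n → Bool) → ℕ
size {m} {n} F = ∑² m n (λ i j → 𝟙 (F i j))

-- Markov's inequality for the product weight r s per agreement and b per
-- disagreement inside F, whose mean over a single entry is at most b + s.
chernoff : ∀ {r m n} (F : Fin m → Fin n → Bool) (χ : Matrix r m n) h b s → b ≤ r * s →
  ∑ (matrices r m n) (λ ψ → 𝟙 (h ≤ᵇ agreement F ψ χ)) * ((r * s) ^ h * b ^ size F)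
  ≤ b ^ h * ((r ^ n) ^ m * (b + s) ^ size F)
chernoff {r} {m} {n} F χ h b s b≤rs = begin
  ∑ Ψ (λ ψ → 𝟙 (h ≤ᵇ A ψ)) * (a ^ h * b ^ size F)
    ≡⟨ *-distribʳ-∑ Ψ _ _ ⟩
  ∑ Ψ (λ ψ → 𝟙 (h ≤ᵇ A ψ) * (a ^ h * b ^ size F))
    ≤⟨ ∑-mono Ψ markov ⟩
  ∑ Ψ (λ ψ → b ^ h * ∏² m n (λ i j → weight i j (ψ ⟨ i , j ⟩)))
    ≡⟨ sym (*-distribˡ-∑ Ψ (b ^ h) _) ⟩
  b ^ h * ∑ Ψ (λ ψ → ∏² m n (λ i j → weight i j (ψ ⟨ i , j ⟩)))
    ≤⟨ *-monoʳ-≤ (b ^ h) (∑-matrices-∏² r m n weight _ mean) ⟩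
  b ^ h * ∏² m n (λ i j → r * (b + s) ^ 𝟙 (F i j))
    ≡⟨ cong (b ^ h *_) (trans (∏²-distrib-* {m} {n} (λ _ _ → r) (λ i j → (b + s) ^ 𝟙 (F i j)))
         (cong₂ _*_ ∏²-r (∏²-^ {m} {n} (b + s) (λ i j → 𝟙 (F i j))))) ⟩
  b ^ h * ((r ^ n) ^ m * (b + s) ^ size F) ∎
  where
  open ≤-Reasoning
  a = r * s
  Ψ = matrices r m n
  A D : Matrix r m n → ℕ
  A ψ = agreement F ψ χ
  D ψ = ∑² m n (differs F ψ χ)

  weight : Fin m → Fin n → Fin r → ℕ
  weight i j c = a ^ 𝟙 (F i j ∧ does (c Fin.≟ χ ⟨ i , j ⟩)) * b ^ 𝟙 (F i j ∧ not (does (c Fin.≟ χ ⟨ i , j ⟩)))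

  ∏²-r : ∏² m n (λ _ _ → r) ≡ (r ^ n) ^ m
  ∏²-r = trans (∏-cong (allFin m) (λ _ → trans (∏-const (allFin n) r) (cong (r ^_) (length-allFin n))))
               (trans (∏-const (allFin m) (r ^ n)) (cong ((r ^ n) ^_) (length-allFin m)))

  mean : ∀ i j → ∑ (allFin r) (weight i j) ≤ r * (b + s) ^ 𝟙 (F i j)
  mean i j with F i j
  ... | false = ≤-reflexive (trans (∑-const (allFin r) 1) (cong (_* 1) (length-allFin r)))
  ... | true  = begin
    ∑ (allFin r) (λ c → a ^ 𝟙 (does (c Fin.≟ x)) * b ^ 𝟙 (not (does (c Fin.≟ x))))
      ≤⟨ ∑-mono (allFin r) (λ c → entry (does (c Fin.≟ x))) ⟩
    ∑ (allFin r) (λ c → b + a * 𝟙 (does (c Fin.≟ x)))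
      ≡⟨ ∑-distrib-+ (allFin r) (λ _ → b) _ ⟩
    ∑ (allFin r) (λ _ → b) + ∑ (allFin r) (λ c → a * 𝟙 (does (c Fin.≟ x)))
      ≡⟨ cong₂ _+_ (trans (∑-const (allFin r) b) (cong (_* b) (length-allFin r)))
           (trans (sym (*-distribˡ-∑ (allFin r) a _)) (cong (a *_) (∑-𝟙-≟ x))) ⟩
    r * b + r * s * 1
      ≡⟨ collect r b s ⟩
    r * ((b + s) * 1) ∎
    where
    x = χ ⟨ i , j ⟩
    entry : ∀ p → a ^ 𝟙 p * b ^ 𝟙 (not p) ≤ b + a * 𝟙 p
    entry true  = ≤-trans (≤-reflexive (trans (*-identityʳ (a * 1)) refl)) (m≤n+m (a * 1) b)
    entry false = ≤-reflexive (unit a b)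
      where
      unit : ∀ a b → 1 * (b * 1) ≡ b + a * 0
      unit = solve-∀
    collect : ∀ r b s → r * b + r * s * 1 ≡ r * ((b + s) * 1)
    collect = solve-∀

  split : ∀ ψ → size F ≡ A ψ + D ψ
  split ψ = trans (∑²-cong {m} {n} (λ i j → parts (F i j) (does (ψ ⟨ i , j ⟩ Fin.≟ χ ⟨ i , j ⟩))))
                  (∑²-distrib-+ {m} {n} (agrees F ψ χ) (differs F ψ χ))
    where
    parts : ∀ p q → 𝟙 p ≡ 𝟙 (p ∧ q) + 𝟙 (p ∧ not q)
    parts false q     = refl
    parts true  true  = refl
    parts true  false = refl

  ∏²-weight : ∀ ψ → ∏² m n (λ i j → weight i j (ψ ⟨ i , j ⟩)) ≡ a ^ A ψ * b ^ D ψ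
  ∏²-weight ψ = trans
    (∏²-distrib-* {m} {n} (λ i j → a ^ agrees F ψ χ i j) (λ i j → b ^ differs F ψ χ i j))
    (cong₂ _*_ (∏²-^ {m} {n} a (agrees F ψ χ)) (∏²-^ {m} {n} b (differs F ψ χ)))

  markov : ∀ ψ → 𝟙 (h ≤ᵇ A ψ) * (a ^ h * b ^ size F)
                 ≤ b ^ h * ∏² m n (λ i j → weight i j (ψ ⟨ i , j ⟩))
  markov ψ with h ≤ᵇ A ψ in eq
  ... | false = z≤n
  ... | true  = begin
    1 * (a ^ h * b ^ size F)          ≡⟨ *-identityˡ _ ⟩
    a ^ h * b ^ size F                ≡⟨ cong (λ e → a ^ h * b ^ e) (trans (split ψ) (cong (_+ D ψ) A≡)) ⟩
    a ^ h * b ^ (h + z + D ψ)         ≡⟨ cong (a ^ h *_) (trans (^-distribˡ-+-* b (h + z) (D ψ)) (cong (_* b ^ D ψ) (^-distribˡ-+-* b h z))) ⟩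
    -- The z agreements beyond h are charged b instead of r s, which errs in the right direction
    -- because b ≤ r s.
    a ^ h * (b ^ h * b ^ z * b ^ D ψ) ≤⟨ *-monoʳ-≤ (a ^ h) (*-monoˡ-≤ (b ^ D ψ) (*-monoʳ-≤ (b ^ h) (^-monoˡ-≤ z b≤rs))) ⟩
    a ^ h * (b ^ h * a ^ z * b ^ D ψ) ≡⟨ shuffle (a ^ h) (b ^ h) (a ^ z) (b ^ D ψ) ⟩
    b ^ h * (a ^ h * a ^ z * b ^ D ψ) ≡⟨ cong (λ e → b ^ h * (e * b ^ D ψ)) (trans (sym (^-distribˡ-+-* a h z)) (cong (a ^_) (sym A≡))) ⟩
    b ^ h * (a ^ A ψ * b ^ D ψ)       ≡⟨ cong (b ^ h *_) (sym (∏²-weight ψ)) ⟩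
    b ^ h * ∏² m n (λ i j → weight i j (ψ ⟨ i , j ⟩)) ∎
    where
    z = A ψ ∸ h
    h≤A : h ≤ A ψ
    h≤A = ≤ᵇ⇒≤ h (A ψ) (subst T (sym eq) _)
    A≡ : A ψ ≡ h + z
    A≡ = sym (m+[n∸m]≡n h≤A)
    shuffle : ∀ x y z w → x * (y * z * w) ≡ y * (x * z * w)
    shuffle = solve-∀

-- Grid colorings from families of colorings of a complete graph

-- The grid consists of n copies of K_m and m copies of K_n. A table colors the former; with m and n
-- exchanged, the latter.
Table : ℕ → ℕ → ℕ → Set
Table r m n = Fin n → Fin m → Fin m → Fin r

Avoids : ∀ {r m n} → Table r m n → Table r n m → Set
Avoids {m = m} {n} A B = ∀ (i i′ : Fin m) (j j′ : Fin n) → i <ᶠ i′ → j <ᶠ j′ →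
  ¬ (A j i i′ ≡ A j′ i i′ × B i j j′ ≡ B i′ j j′)

module _ {r m n} (A : Table r m n) (B : Table r n m) where

  private
    -- Each edge takes its color from the table entry with increasing indices.
    paint : ∀ (u v : Vertex m n) →
      Tri (proj₁ u <ᶠ proj₁ v) (proj₁ u ≡ proj₁ v) (proj₁ v <ᶠ proj₁ u) →
      Tri (proj₂ u <ᶠ proj₂ v) (proj₂ u ≡ proj₂ v) (proj₂ v <ᶠ proj₂ u) → Fin r
    paint (i , j) (i′ , j′) (tri< _ _ _) _            = A j i i′
    paint (i , j) (i′ , j′) (tri> _ _ _) _            = A j′ i′ i
    paint (i , j) (i′ , j′) (tri≈ _ _ _) (tri< _ _ _) = B i j j′
    -- Here u = v, which is never an edge; the diagonal entry serves as a symmetric default.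
    paint (i , j) (i′ , j′) (tri≈ _ _ _) (tri≈ _ _ _) = B i j j′
    paint (i , j) (i′ , j′) (tri≈ _ _ _) (tri> _ _ _) = B i′ j′ j

    paint-sym : ∀ u v p q p′ q′ → paint u v p q ≡ paint v u p′ q′
    paint-sym u v (tri< _ _ _)  _ (tri> _ _ _) _ = refl
    paint-sym u v (tri> _ _ _)  _ (tri< _ _ _) _ = refl
    paint-sym u v (tri< a _ _)  _ (tri< _ _ ¬a) _ = contradiction a ¬a
    paint-sym u v (tri< _ ¬b _) _ (tri≈ _ b _) _ = contradiction (sym b) ¬b
    paint-sym u v (tri> _ _ c)  _ (tri> ¬c _ _) _ = contradiction c ¬c
    paint-sym u v (tri> _ ¬b _) _ (tri≈ _ b _) _ = contradiction (sym b) ¬b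
    paint-sym u v (tri≈ _ b _)  _ (tri< _ ¬b _) _ = contradiction (sym b) ¬b
    paint-sym u v (tri≈ _ b _)  _ (tri> _ ¬b _) _ = contradiction (sym b) ¬b
    paint-sym u v (tri≈ _ _ _) (tri< _ _ _) (tri≈ _ _ _) (tri> _ _ _) = refl
    paint-sym u v (tri≈ _ _ _) (tri> _ _ _) (tri≈ _ _ _) (tri< _ _ _) = refl
    paint-sym u v (tri≈ _ refl _) (tri≈ _ refl _) (tri≈ _ _ _) (tri≈ _ _ _) = refl
    paint-sym u v (tri≈ _ _ _) (tri< a _ _) (tri≈ _ _ _) (tri< _ _ ¬a) = contradiction a ¬a
    paint-sym u v (tri≈ _ _ _) (tri< _ ¬b _) (tri≈ _ _ _) (tri≈ _ b _) = contradiction (sym b) ¬b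
    paint-sym u v (tri≈ _ _ _) (tri> _ _ c) (tri≈ _ _ _) (tri> ¬c _ _) = contradiction c ¬c
    paint-sym u v (tri≈ _ _ _) (tri> _ ¬b _) (tri≈ _ _ _) (tri≈ _ b _) = contradiction (sym b) ¬b
    paint-sym u v (tri≈ _ _ _) (tri≈ _ b _) (tri≈ _ _ _) (tri< _ ¬b _) = contradiction (sym b) ¬b
    paint-sym u v (tri≈ _ _ _) (tri≈ _ b _) (tri≈ _ _ _) (tri> _ ¬b _) = contradiction (sym b) ¬b

    paint₁ : ∀ {i i′} j p q → i <ᶠ i′ → paint (i , j) (i′ , j) p q ≡ A j i i′
    paint₁ j (tri< _ _ _)  _ _    = refl
    paint₁ j (tri≈ ¬a _ _) _ i<i′ = contradiction i<i′ ¬a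
    paint₁ j (tri> ¬a _ _) _ i<i′ = contradiction i<i′ ¬a

    paint₂ : ∀ i {j j′} p q → j <ᶠ j′ → paint (i , j) (i , j′) p q ≡ B i j j′
    paint₂ i (tri< _ ¬b _) _            _    = contradiction refl ¬b
    paint₂ i (tri> _ ¬b _) _            _    = contradiction refl ¬b
    paint₂ i (tri≈ _ _ _) (tri< _ _ _)  _    = refl
    paint₂ i (tri≈ _ _ _) (tri≈ ¬a _ _) j<j′ = contradiction j<j′ ¬a
    paint₂ i (tri≈ _ _ _) (tri> ¬a _ _) j<j′ = contradiction j<j′ ¬a

  tables⇒colorable : Avoids A B → Colorable m n r
  tables⇒colorable avoids = coloring , λ {i} {i′} {j} {j′} i<i′ j<j′ (eq₁ , eq₂) →
    avoids i i′ j j′ i<i′ j<j′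
      ( trans (sym (paint₁ j (Fin.<-cmp i i′) (Fin.<-cmp j j) i<i′))
          (trans eq₁ (paint₁ j′ (Fin.<-cmp i i′) (Fin.<-cmp j′ j′) i<i′))
      , trans (sym (paint₂ i (Fin.<-cmp i i) (Fin.<-cmp j j′) j<j′))
          (trans eq₂ (paint₂ i′ (Fin.<-cmp i′ i′) (Fin.<-cmp j j′) j<j′)))
    where
    cmp₁ = λ (u v : Vertex m n) → Fin.<-cmp (proj₁ u) (proj₁ v)
    cmp₂ = λ (u v : Vertex m n) → Fin.<-cmp (proj₂ u) (proj₂ v)
    coloring : EdgeColoring m n r
    coloring = record
      { color     = λ u v _ → paint u v (cmp₁ u v) (cmp₂ u v)
      ; color-sym = λ u v _ _ → paint-sym u v (cmp₁ u v) (cmp₂ u v) (cmp₁ v u) (cmp₂ v u)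
      }

-- `color-sym` ties all proofs of `Adj u v` to one and the same proof of `Adj v u`.
color-irrelevant : ∀ {m n r} (c : EdgeColoring m n r) u v p q → color c u v p ≡ color c u v q
color-irrelevant c u v p q = trans (color-sym c u v p flipped) (sym (color-sym c u v q flipped))
  where
  flipped : Adj v u
  flipped with proj₂ p
  ... | inj₁ eq = proj₁ p ∘ sym , inj₁ (sym eq)
  ... | inj₂ eq = proj₁ p ∘ sym , inj₂ (sym eq)

-- Converse of `tables⇒colorable`, for the sake of deciding `Colorable`. A color must exist as
-- default for index pairs that are not increasing, hence `suc r`.
colorable⇒tables : ∀ {r m n} → Colorable m n (suc r) →
  Σ (Table (suc r) m n) λ A → Σ (Table (suc r) n m) λ B → Avoids A B
colorable⇒tables {r} {m} {n} (c , free) = A , B , λ i i′ j j′ i<i′ j<j′ (eq₁ , eq₂) →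
  free i<i′ j<j′
    ( trans (sym (A≡ j i<i′)) (trans eq₁ (A≡ j′ i<i′))
    , trans (sym (B≡ i j<j′)) (trans eq₂ (B≡ i′ j<j′)))
  where
  A : Table (suc r) m n
  A j i i′ with i Fin.<? i′
  ... | yes i<i′ = color c (i , j) (i′ , j) (edge₁ j i<i′)
  ... | no _     = zero
  B : Table (suc r) n m
  B i j j′ with j Fin.<? j′
  ... | yes j<j′ = color c (i , j) (i , j′) (edge₂ i j<j′)
  ... | no _     = zero
  A≡ : ∀ j {i i′} (i<i′ : i <ᶠ i′) → A j i i′ ≡ color c (i , j) (i′ , j) (edge₁ j i<i′)
  A≡ j {i} {i′} i<i′ with i Fin.<? i′
  ... | yes p = color-irrelevant c _ _ _ _
  ... | no ¬p = contradiction i<i′ ¬p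
  B≡ : ∀ i {j j′} (j<j′ : j <ᶠ j′) → B i j j′ ≡ color c (i , j) (i , j′) (edge₂ i j<j′)
  B≡ i {j} {j′} j<j′ with j Fin.<? j′
  ... | yes p = color-irrelevant c _ _ _ _
  ... | no ¬p = contradiction j<j′ ¬p

-- Deciding colorability; the minimum g

private
  -- Tables are functions, so exhaustive search ranges over vectors instead. Decoding recovers a
  -- table only pointwise, which is enough for `Avoids`.
  code : ∀ {r m n} → Table r m n → Vec (Matrix r m m) n
  code A = tabulate (λ j → tabulate (λ i → tabulate (A j i)))

  decode : ∀ {r m n} → Vec (Matrix r m m) n → Table r m n
  decode v j i i′ = lookup v j ⟨ i , i′ ⟩

  decode∘code : ∀ {r m n} (A : Table r m n) j i i′ → decode (code A) j i i′ ≡ A j i i′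
  decode∘code A j i i′ = trans
    (cong (λ M → lookup (lookup M i) i′) (lookup∘tabulate _ j))
    (trans (cong (λ v → lookup v i′) (lookup∘tabulate _ i)) (lookup∘tabulate (A j i) i′))

  avoids? : ∀ {r m n} (A : Table r m n) (B : Table r n m) → Dec (Avoids A B)
  avoids? A B = Fin.all? λ i → Fin.all? λ i′ → Fin.all? λ j → Fin.all? λ j′ →
    (i Fin.<? i′) →-dec ((j Fin.<? j′) →-dec
      ¬? ((A j i i′ Fin.≟ A j′ i i′) ×-dec (B i j j′ Fin.≟ B i′ j j′)))

  tables : ∀ r m n → List (Vec (Matrix r m m) n)
  tables r m n = words (matrices r m m) n

  ∈-tables : ∀ {r m n} (v : Vec (Matrix r m m) n) → v ∈ tables r m n
  ∈-tables = ∈-words (∈-words (∈-words ∈-allFin))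

  adjacent? : ∀ m n → Dec (∃ λ (u : Vertex m n) → ∃ λ v → Adj u v)
  adjacent? m n = map′ (λ (i , j , i′ , j′ , p) → (i , j) , (i′ , j′) , p)
                       (λ ((i , j) , (i′ , j′) , p) → i , j , i′ , j′ , p)
    (Fin.any? λ i → Fin.any? λ j → Fin.any? λ i′ → Fin.any? λ j′ → adj? i j i′ j′)
    where
    adj? : ∀ {m n} i j i′ j′ → Dec (Adj {m} {n} (i , j) (i′ , j′))
    adj? i j i′ j′ = ¬? (map′ (λ (p , q) → cong₂ _,_ p q) (λ eq → cong proj₁ eq , cong proj₂ eq)
                           ((i Fin.≟ i′) ×-dec (j Fin.≟ j′)))
                     ×-dec ((i Fin.≟ i′) ⊎-dec (j Fin.≟ j′))

-- Without colors, a coloring exists exactly if the grid has no edges; otherwise all pairs of coded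
-- tables are tried.
colorable? : ∀ m n r → Dec (Colorable m n r)
colorable? m n zero with adjacent? m n
... | yes (u , v , p) = no (λ (c , _) → case0 (color c u v p))
  where
  case0 : Fin 0 → _
  case0 ()
... | no ¬adj = yes
  ( record { color     = λ u v p → contradiction (u , v , p) ¬adj
           ; color-sym = λ u v p _ → contradiction (u , v , p) ¬adj }
  , λ {i} {i′} {j} i<i′ _ _ → ¬adj (_ , _ , edge₁ j i<i′))
colorable? m n (suc r) = map′ to from
  (any? (λ v → any? (λ w → avoids? (decode v) (decode w)) (tables (suc r) n m)) (tables (suc r) m n))
  where
  to : Any.Any (λ v → Any.Any (λ w → Avoids (decode v) (decode w)) _) _ → Colorable m n (suc r)
  to p with Any.satisfied p
  ... | v , q with Any.satisfied q
  ... | w , avoids = tables⇒colorable (decode v) (decode w) avoids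
  from : Colorable m n (suc r) → Any.Any (λ v → Any.Any (λ w → Avoids (decode v) (decode w)) _) _
  from c with colorable⇒tables c
  ... | A , B , avoids = lose (∈-tables (code A)) (lose (∈-tables (code B))
    λ i i′ j j′ i<i′ j<j′ (eq₁ , eq₂) → avoids i i′ j j′ i<i′ j<j′
      ( trans (sym (decode∘code A j i i′)) (trans eq₁ (decode∘code A j′ i i′))
      , trans (sym (decode∘code B i j j′)) (trans eq₂ (decode∘code B i′ j j′))))

least : ∀ {P : ℕ → Set} → Decidable P → ∀ {r} → P r → ∃[ k ] ((P k × (∀ k′ → P k′ → k ≤ k′)) × k ≤ r)
least {P} P? {zero}  p = zero , (p , λ _ _ → z≤n) , z≤n
least {P} P? {suc r} p with P? zero
... | yes p₀ = zero , (p₀ , λ _ _ → z≤n) , z≤n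
... | no ¬p₀ with least {P ∘ suc} (P? ∘ suc) p
... | k , (pₖ , min) , k≤r = suc k , (pₖ , min′) , s≤s k≤r
  where
  min′ : ∀ k′ → P k′ → suc k ≤ k′
  min′ zero     p₀ = contradiction p₀ ¬p₀
  min′ (suc k′) p  = s≤s (min k′ p)

colorable⇒g≤ : ∀ {m n r} → Colorable m n r → ∃[ k ] ((g⟨ m , n ⟩≡ k) × k ≤ r)
colorable⇒g≤ {m} {n} = least (colorable? m n)

-- N colorings of the edges of K_V, such that for any two of them the edges on
-- which they agree form a graph that is properly colored with r colors by κ.
record Family (N V r : ℕ) : Set where
  field
    χ      : Fin N → Fin V → Fin V → Fin r
    κ      : Fin N → Fin N → Fin V → Fin r
    proper : ∀ {i i′ j j′} → i <ᶠ i′ → j <ᶠ j′ → χ i j j′ ≡ χ i′ j j′ → κ i i′ j ≢ κ i i′ j′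

restrict : ∀ {N V r N′ V′} → N′ ≤ N → V′ ≤ V → Family N V r → Family N′ V′ r
restrict {N} {V} {_} {N′} {V′} N′≤N V′≤V F = record
  { χ = λ i j j′ → Family.χ F (inject≤ i N′≤N) (inject≤ j V′≤V) (inject≤ j′ V′≤V)
  ; κ = λ i i′ j → Family.κ F (inject≤ i N′≤N) (inject≤ i′ N′≤N) (inject≤ j V′≤V)
  ; proper = λ i<i′ j<j′ → Family.proper F (mono N′≤N i<i′) (mono V′≤V j<j′)
  }
  where
  mono : ∀ {a b} (a≤b : a ≤ b) {i j : Fin a} → i <ᶠ j → inject≤ i a≤b <ᶠ inject≤ j a≤b
  mono a≤b {i} {j} i<j = subst₂ _<_ (sym (Fin.toℕ-inject≤ i a≤b)) (sym (Fin.toℕ-inject≤ j a≤b)) i<j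

-- Row i carries the coloring χ i; in column j the edge between rows i and i′ gets the color of
-- vertex j under κ i i′. An alternating rectangle would be an edge of the agreement graph whose two
-- ends have the same color.
family⇒colorable : ∀ {N V r} → Family N V r → Colorable N V r
family⇒colorable F = tables⇒colorable (λ j i i′ → Family.κ F i i′ j) (Family.χ F)
  λ i i′ j j′ i<i′ j<j′ (eq₁ , eq₂) → Family.proper F i<i′ j<j′ eq₂ eq₁

-- The form for (iii), where the colorings are indexed by the second side and the first side, of
-- order r², is the vertex set.
family⇒colorableᵀ : ∀ {N V r} → Family N V r → Colorable V N r
family⇒colorableᵀ F = tables⇒colorable (Family.χ F) (λ j i i′ → Family.κ F i i′ j)
  λ j j′ i i′ j<j′ i<i′ (eq₁ , eq₂) → Family.proper F i<i′ j<j′ eq₁ eq₂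

-- Families from codes

[m*n]^o : ∀ m n o → (m * n) ^ o ≡ m ^ o * n ^ o
[m*n]^o m n zero    = refl
[m*n]^o m n (suc o) = trans (cong (m * n *_) ([m*n]^o m n o)) (swap m n (m ^ o) (n ^ o))
  where
  swap : ∀ a b c d → a * b * (c * d) ≡ a * c * (b * d)
  swap = solve-∀

^-cancelʳ-≤ : ∀ {m n} o .{{_ : NonZero o}} → m ^ o ≤ n ^ o → m ≤ n
^-cancelʳ-≤ o mᵒ≤nᵒ = ≮⇒≥ λ n<m → <⇒≱ (^-monoˡ-< o n<m) mᵒ≤nᵒ

^-cancelʳ-< : ∀ {m n} o → m ^ o < n ^ o → m < n
^-cancelʳ-< o mᵒ<nᵒ = ≰⇒> λ n≤m → <⇒≱ mᵒ<nᵒ (^-monoˡ-≤ o n≤m)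

count : ∀ {t} → (Fin t → Bool) → ℕ
count {zero}  S = 0
count {suc t} S = 𝟙 (S zero) + count (S ∘ suc)

count≡∑ : ∀ {t} (S : Fin t → Bool) → count S ≡ ∑ (allFin t) (𝟙 ∘ S)
count≡∑ {zero}  S = refl
count≡∑ {suc t} S = trans (cong (𝟙 (S zero) +_) (count≡∑ (S ∘ suc))) (sym (∑-allFin-suc (𝟙 ∘ S)))

private
  cons : ∀ b k → Fin 2 → Fin (2 ^ k) → Fin (2 ^ (𝟙 b + k))
  cons true  k x e = combine x e
  cons false k x e = e

  cons-injectiveˡ : ∀ b k x y {e e′} → cons b k x e ≡ cons b k y e′ → T b → x ≡ y
  cons-injectiveˡ true k x y eq _ = Fin.combine-injectiveˡ x _ y _ eq

  cons-injectiveʳ : ∀ b k x y {e e′} → cons b k x e ≡ cons b k y e′ → e ≡ e′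
  cons-injectiveʳ true  k x y eq = Fin.combine-injectiveʳ x _ y _ eq
  cons-injectiveʳ false k x y eq = eq

-- The bits at the positions of S packed into a single number: the future proper coloring of an
-- agreement graph.
projection : ∀ {t} (S : Fin t → Bool) → (Fin t → Fin 2) → Fin (2 ^ count S)
projection {zero}  S x = zero
projection {suc t} S x = cons (S zero) (count (S ∘ suc)) (x zero) (projection (S ∘ suc) (x ∘ suc))

projection-injective : ∀ {t} (S : Fin t → Bool) x y → projection S x ≡ projection S y →
  ∀ c → T (S c) → x c ≡ y c
projection-injective S x y eq zero    c∈S =
  cons-injectiveˡ (S zero) (count (S ∘ suc)) (x zero) (y zero) eq c∈S
projection-injective S x y eq (suc c) c∈S = projection-injective (S ∘ suc) (x ∘ suc) (y ∘ suc)
  (cons-injectiveʳ (S zero) (count (S ∘ suc)) (x zero) (y zero) eq) c c∈S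

funToFin-cong : ∀ {m n} {f g : Fin m → Fin n} → (∀ i → f i ≡ g i) → funToFin f ≡ funToFin g
funToFin-cong {zero}  f≗g = refl
funToFin-cong {suc m} f≗g = cong₂ combine (f≗g zero) (funToFin-cong (f≗g ∘ suc))

bit : ∀ t → Fin (2 ^ t) → Fin t → Fin 2
bit t = finToFun {2} {t}

bit-injective : ∀ t (x y : Fin (2 ^ t)) → (∀ c → bit t x c ≡ bit t y c) → x ≡ y
bit-injective t x y eq = trans (sym (Fin.funToFin-finToFin {t} x))
  (trans (funToFin-cong {t} {f = bit t x} {g = bit t y} eq) (Fin.funToFin-finToFin {t} y))

differ? : ∀ t (x y : Fin (2 ^ t)) → Dec (∃[ c ] bit t x c ≢ bit t y c)
differ? t x y = Fin.any? λ c → ¬? (bit t x c Fin.≟ bit t y c)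

𝟙≤1 : ∀ b → 𝟙 b ≤ 1
𝟙≤1 true  = ≤-refl
𝟙≤1 false = z≤n

private
  everything : ∀ {t} → Fin 1 → Fin t → Bool
  everything _ _ = true

  size-everything : ∀ t → size (everything {t}) ≡ t
  size-everything t = trans (+-identityʳ _)
    (trans (∑-const (allFin t) 1) (trans (*-identityʳ _) (length-allFin t)))

  agreement≤t : ∀ {r t} (ψ χ : Matrix r 1 t) → agreement everything ψ χ ≤ t
  agreement≤t {t = t} ψ χ = ≤-trans
    (∑²-mono {g = λ _ _ → 1} (λ i j → 𝟙≤1 (does (ψ ⟨ i , j ⟩ Fin.≟ χ ⟨ i , j ⟩))))
    (≤-reflexive (size-everything t))

bad≡0⇒< : ∀ {L A} → 𝟙 (L ≤ᵇ A) ≡ 0 → A < L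
bad≡0⇒< {L} {A} eq with L ≤ᵇ A in L≤A
... | false = ≰⇒> (λ L≤A′ → subst T L≤A (≤⇒≤ᵇ L≤A′))

<⇒bad≡0 : ∀ {L A} → A < L → 𝟙 (L ≤ᵇ A) ≡ 0
<⇒bad≡0 {L} {A} A<L with L ≤ᵇ A in L≤A
... | false = refl
... | true  = contradiction (≤ᵇ⇒≤ L A (subst T (sym L≤A) _)) (<⇒≱ A<L)

-- Chernoff with weights t and L over all positions: since (t + L) ^ t ≤ 4 ^ L * t ^ t, a fraction
-- of at most (4t / (rL)) ^ L of the words agrees with χ in L places. If t < L, no word does.
few-agreements : ∀ r t L m .{{_ : NonZero r}} .{{_ : NonZero L}} →
  t < L ⊎ m * (4 * t) ^ L < (r * L) ^ L → ∀ χ →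
  m * ∑ (matrices r 1 t) (λ ψ → 𝟙 (L ≤ᵇ agreement everything ψ χ)) < (r ^ t) ^ 1
few-agreements r t L zero    _          χ = m^n>0 (r ^ t) {{m^n≢0 r t}} 1
few-agreements r t L m@(suc _) (inj₁ t<L) χ =
  subst (_< (r ^ t) ^ 1) (sym (trans (cong (m *_) all0) (*-zeroʳ m))) (m^n>0 (r ^ t) {{m^n≢0 r t}} 1)
  where
  all0 : ∑ (matrices r 1 t) (λ ψ → 𝟙 (L ≤ᵇ agreement everything ψ χ)) ≡ 0
  all0 = trans (∑-cong (matrices r 1 t) (λ ψ → <⇒bad≡0 (≤-<-trans (agreement≤t ψ χ) t<L)))
               (trans (∑-const (matrices r 1 t) 0) (*-zeroʳ (length (matrices r 1 t))))
few-agreements r zero    (suc L) m@(suc _) (inj₂ lt) χ = few-agreements r 0 (suc L) m (inj₁ z<s) χ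
few-agreements r t@(suc _) L m@(suc _) (inj₂ lt) χ =
  *-cancelʳ-< ((r * L) ^ L) (m * C) N (begin-strict
    m * C * (r * L) ^ L            ≡⟨ *-assoc m C _ ⟩
    m * (C * (r * L) ^ L)          ≤⟨ *-monoʳ-≤ m bound ⟩
    m * (N * (4 * t) ^ L)          ≡⟨ rearrange m N _ ⟩
    N * (m * (4 * t) ^ L)          <⟨ *-monoʳ-< N {{m^n≢0 (r ^ t) 1 {{m^n≢0 r t}}}} lt ⟩
    N * (r * L) ^ L                ∎)
  where
  open ≤-Reasoning
  C = ∑ (matrices r 1 t) (λ ψ → 𝟙 (L ≤ᵇ agreement everything ψ χ))
  N = (r ^ t) ^ 1
  rearrange : ∀ a b c → a * (b * c) ≡ b * (a * c)
  rearrange = solve-∀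
  gather : ∀ a b c d → a * (b * (c * d)) ≡ b * (c * a) * d
  gather = solve-∀
  -- As m ≥ 1, the hypothesis forces 4 t < r L, whence the condition b ≤ r s of `chernoff`.
  t≤rL : t ≤ r * L
  t≤rL = ≤-trans (m≤m+n t _) (<⇒≤ (^-cancelʳ-< L (≤-<-trans (m≤n*m _ m) lt)))
  bound : C * (r * L) ^ L ≤ N * (4 * t) ^ L
  bound = *-cancelʳ-≤ _ _ (t ^ t) {{m^n≢0 t t}} (begin
    C * (r * L) ^ L * t ^ t            ≡⟨ *-assoc C _ _ ⟩
    C * ((r * L) ^ L * t ^ t)          ≤⟨ subst (λ z → C * ((r * L) ^ L * t ^ z) ≤ t ^ L * (N * (t + L) ^ z)) (size-everything t) (chernoff everything χ L t L t≤rL) ⟩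
    t ^ L * (N * (t + L) ^ t)          ≤⟨ *-monoʳ-≤ (t ^ L) (*-monoʳ-≤ N ([b+s]^b≤4^s*b^b t L ≤-refl)) ⟩
    t ^ L * (N * (4 ^ L * t ^ t))      ≡⟨ gather (t ^ L) N (4 ^ L) (t ^ t) ⟩
    N * (4 ^ L * t ^ L) * t ^ t        ≡⟨ cong (λ z → N * z * t ^ t) (sym ([m*n]^o 4 t L)) ⟩
    N * (4 * t) ^ L * t ^ t            ∎)

-- The position found by `differ?` depends only on x and y, not on the word. Equal colors of x y
-- under the words i and i′ therefore place it in S i i′, where the projections of x and y must then
-- differ.
codeFamily : ∀ r t l m → 2 ^ l ≤ r →
  t < suc l ⊎ m * (4 * t) ^ suc l < (r * suc l) ^ suc l → Family (suc m) (2 ^ t) r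
codeFamily zero    t l m 2^l≤r _ = contradiction 2^l≤r (<⇒≱ (m^n>0 2 l))
codeFamily r@(suc _) t l m 2^l≤r h = record
  { χ = λ i x y → letter i (differ? t x y)
  ; κ = λ i i′ → restriction i i′ (2 ^ count (S i i′) ≤? r)
  ; proper = λ {i} {i′} {x} {y} → proper′ (differ? t x y) (2 ^ count (S i i′) ≤? r)
  }
  where
  len : length (matrices r 1 t) ≡ (r ^ t) ^ 1
  len = length-matrices r 1 t
  codewords = greedy (matrices r 1 t) (λ ψ χ → 𝟙 (suc l ≤ᵇ agreement everything ψ χ)) m
    (subst (0 <_) (sym len) (m^n>0 (r ^ t) {{m^n≢0 r t}} 1))
    (λ χ → subst (m * ∑ (matrices r 1 t) (λ ψ → 𝟙 (suc l ≤ᵇ agreement everything ψ χ)) <_) (sym len) (few-agreements r t (suc l) m h χ))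
  word : Fin (suc m) → Fin t → Fin r
  word i c = proj₁ codewords i ⟨ zero , c ⟩
  S : Fin (suc m) → Fin (suc m) → Fin t → Bool
  S i i′ c = does (word i c Fin.≟ word i′ c)

  letter : ∀ {x y} → Fin (suc m) → Dec (∃[ c ] bit t x c ≢ bit t y c) → Fin r
  letter i (yes (c , _)) = word i c
  letter i (no _)        = zero

  restriction : ∀ i i′ → Dec (2 ^ count (S i i′) ≤ r) → Fin (2 ^ t) → Fin r
  restriction i i′ (yes p) x = inject≤ (projection (S i i′) (bit t x)) p
  -- Default for pairs without a bound on their agreements; by `small` it does not occur for i < i′.
  restriction i i′ (no _)  x = zero

  small : ∀ {i i′} → i <ᶠ i′ → 2 ^ count (S i i′) ≤ r
  small {i} {i′} i<i′ = ≤-trans (^-monoʳ-≤ 2 (s≤s⁻¹ (subst (_< suc l)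
    (trans (+-identityʳ _) (sym (count≡∑ (S i i′)))) (bad≡0⇒< (proj₂ codewords i<i′))))) 2^l≤r

  proper′ : ∀ {i i′ x y} d e → i <ᶠ i′ → x <ᶠ y → letter {x} {y} i d ≡ letter i′ d →
    restriction i i′ e x ≢ restriction i i′ e y
  proper′ {x = x} {y} (no ¬diff) _ i<i′ x<y same eq = Fin.<⇒≢ x<y (bit-injective t x y λ c →
    decidable-stable (bit t x c Fin.≟ bit t y c) λ ≠ → ¬diff (c , ≠))
  proper′ (yes _) (no ¬p) i<i′ x<y same eq = ¬p (small i<i′)
  proper′ {i} {i′} {x} {y} (yes (c , x≢y)) (yes p) i<i′ x<y same eq =
    x≢y (projection-injective (S i i′) (bit t x) (bit t y) (Fin.inject≤-injective p p _ _ eq) c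
      (subst T (sym (dec-true (word i c Fin.≟ word i′ c) same)) _))

-- Families from random colorings

-- The exponent is cut into at most k blocks of length at most b, each costing 4 ^ s.
[b+s]^c≤4^sk*b^c : ∀ b s k {c} → c ≤ k * b → (b + s) ^ c ≤ 4 ^ (s * k) * b ^ c
[b+s]^c≤4^sk*b^c b s zero    {zero} z≤n = ≤-trans ≤-refl (*-monoˡ-≤ 1 (m^n>0 4 (s * 0)))
[b+s]^c≤4^sk*b^c b s (suc k) {c} c≤b+kb = begin
  (b + s) ^ c                                         ≡⟨ split (b + s) ⟩
  (b + s) ^ (c ⊓ b) * (b + s) ^ (c ∸ b)               ≤⟨ *-mono-≤ ([b+s]^b≤4^s*b^b b s (m⊓n≤n c b))
                                                          ([b+s]^c≤4^sk*b^c b s k (m≤n+o⇒m∸n≤o c b c≤b+kb)) ⟩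
  4 ^ s * b ^ (c ⊓ b) * (4 ^ (s * k) * b ^ (c ∸ b))   ≡⟨ gather (4 ^ s) (b ^ (c ⊓ b)) (4 ^ (s * k)) (b ^ (c ∸ b)) ⟩
  4 ^ s * 4 ^ (s * k) * (b ^ (c ⊓ b) * b ^ (c ∸ b))   ≡⟨ cong₂ _*_ (trans (sym (^-distribˡ-+-* 4 s (s * k))) (cong (4 ^_) (sym (*-suc s k)))) (sym (split b)) ⟩
  4 ^ (s * suc k) * b ^ c                             ∎
  where
  open ≤-Reasoning
  split : ∀ x → x ^ c ≡ x ^ (c ⊓ b) * x ^ (c ∸ b)
  split x = trans (cong (x ^_) (trans (sym (m⊓n+n∸m≡n b c)) (cong (_+ (c ∸ b)) (⊓-comm b c)))) (^-distribˡ-+-* x (c ⊓ b) (c ∸ b))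
  gather : ∀ a b c d → a * b * (c * d) ≡ a * c * (b * d)
  gather = solve-∀

-- Coloring degenerate graphs

module _ {m : ℕ} where

  member : Vec Bool m → Fin m → ℕ
  member W i = 𝟙 (lookup W i)

  ∣_∣ : Vec Bool m → ℕ
  ∣ W ∣ = ∑ (allFin m) (member W)

  Graph : Set
  Graph = Fin m → Fin m → ℕ

  degree : Graph → Vec Bool m → Fin m → ℕ
  degree G W i = ∑ (allFin m) (λ j → member W j * G i j)

  -- This is (r - 1)-degeneracy in the usual terminology.
  Degenerate : ℕ → Graph → Set
  Degenerate r G = ∀ W → (∃[ i ] T (lookup W i)) → ∃[ i ] (T (lookup W i) × degree G W i < r)

  ∣∣-remove : ∀ W {i} → T (lookup W i) → ∣ W ∣ ≡ suc ∣ W [ i ]≔ false ∣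
  ∣∣-remove W {i} i∈W = trans (∑-cong (allFin m) at)
    (trans (∑-distrib-+ (allFin m) (λ j → 𝟙 (does (j Fin.≟ i))) (member (W [ i ]≔ false)))
           (cong (_+ ∣ W [ i ]≔ false ∣) (∑-𝟙-≟ i)))
    where
    T⇒1 : ∀ {b} → T b → 𝟙 b ≡ 1
    T⇒1 {true} _ = refl
    at : ∀ j → member W j ≡ 𝟙 (does (j Fin.≟ i)) + member (W [ i ]≔ false) j
    at j with j Fin.≟ i
    ... | yes refl = trans (T⇒1 i∈W) (sym (cong (suc ∘ 𝟙) (lookup∘update i W false)))
    ... | no  j≢i  = cong 𝟙 (sym (lookup∘update′ j≢i W false))

  ∈-remove : ∀ (W : Vec Bool m) (i : Fin m) {j : Fin m} → j ≢ i → T (lookup W j) → T (lookup (W [ i ]≔ false) j)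
  ∈-remove W i j≢i = subst T (sym (lookup∘update′ j≢i W false))

  T⇒∣∣>0 : ∀ W {i} → T (lookup W i) → 0 < ∣ W ∣
  T⇒∣∣>0 W i∈W = subst (0 <_) (sym (∣∣-remove W i∈W)) z<s

  -- Remove a vertex of degree at most r, color the rest, then give the vertex one of the r + 1
  -- colors that its neighbors leave free.
  degenerate⇒colorable : ∀ {r} G → (∀ i j → G i j ≡ G j i) → Degenerate (suc r) G →
    Σ (Fin m → Fin (suc r)) λ κ → (∀ {i j} → i ≢ j → G i j ≢ 0 → κ i ≢ κ j)
  degenerate⇒colorable {r} G G-sym degen = κ , λ {i} {j} i≢j e → proper (everyone i) (everyone j) i≢j e
    where
    Proper : Vec Bool m → (Fin m → Fin (suc r)) → Set
    Proper W κ = ∀ {i j} → T (lookup W i) → T (lookup W j) → i ≢ j → G i j ≢ 0 → κ i ≢ κ j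

    freeColor : ∀ W i (κ : Fin m → Fin (suc r)) → degree G W i < suc r →
      ∃[ c ] (∀ {j} → T (lookup W j) → G i j ≢ 0 → κ j ≢ c)
    -- Summed over all colors, the uses by neighbors of i in W add up to the degree, which is below
    -- the number of colors; some color has no use.
    freeColor W i κ low with ∑<length⇒∃0 (allFin (suc r)) uses (subst₂ _<_ (sym total) (sym (length-allFin (suc r))) low)
      where
      uses : Fin (suc r) → ℕ
      uses c = ∑ (allFin m) (λ j → member W j * G i j * 𝟙 (does (c Fin.≟ κ j)))
      total : ∑ (allFin (suc r)) uses ≡ degree G W i
      total = trans (∑-comm (allFin (suc r)) (allFin m) _) (∑-cong (allFin m) λ j →
        trans (sym (*-distribˡ-∑ (allFin (suc r)) (member W j * G i j) _))
              (trans (cong (member W j * G i j *_) (∑-𝟙-≟ (κ j))) (*-identityʳ _)))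
    ... | c , unused = c , λ {j} j∈W adj κj≡c → nonzero j∈W adj (sym κj≡c)
           (∑≡0⇒≡0 (λ j → member W j * G i j * 𝟙 (does (c Fin.≟ κ j))) unused (∈-allFin j))
      where
      nonzero : ∀ {j} → T (lookup W j) → G i j ≢ 0 → c ≡ κ j →
        member W j * G i j * 𝟙 (does (c Fin.≟ κ j)) ≢ 0
      nonzero {j} j∈W adj c≡κj with lookup W j
      ... | true rewrite dec-true (c Fin.≟ κ j) c≡κj = λ eq → adj (trans (sym (trans (*-identityʳ _) (*-identityˡ _))) eq)

    colorSet : ∀ s W → ∣ W ∣ ≤ s → Σ _ (Proper W)
    colorSet s W ∣W∣≤s with Fin.any? (λ i → T? (lookup W i))
    ... | no ¬i∈W = (λ _ → zero) , λ i∈W → contradiction (_ , i∈W) ¬i∈W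
    colorSet zero    W ∣W∣≤0 | yes (i , i∈W) = contradiction ∣W∣≤0 (<⇒≱ (T⇒∣∣>0 W i∈W))
    colorSet (suc s) W ∣W∣≤s | yes nonempty with degen W nonempty
    ... | i , i∈W , low with colorSet s (W [ i ]≔ false) (s≤s⁻¹ (subst (_≤ suc s) (∣∣-remove W i∈W) ∣W∣≤s))
    ... | κ , ok with freeColor W i κ low
    ... | c , free = κ′ , ok′
      where
      κ′ : Fin m → Fin (suc r)
      κ′ j with j Fin.≟ i
      ... | yes _ = c
      ... | no _  = κ j
      ok′ : Proper W κ′
      ok′ {j} {k} j∈W k∈W j≢k adj with j Fin.≟ i | k Fin.≟ i
      ... | yes refl | yes refl = contradiction refl j≢k
      ... | yes refl | no _     = free k∈W adj ∘ sym
      ... | no _     | yes refl = free j∈W (adj ∘ trans (G-sym j k))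
      ... | no j≢i   | no k≢i   = ok (∈-remove W i j≢i j∈W) (∈-remove W i k≢i k∈W) j≢k adj

    coloring = colorSet _ (replicate m true) ≤-refl
    κ = proj₁ coloring
    proper = proj₂ coloring
    everyone : ∀ i → T (lookup (replicate m true) i)
    everyone i = subst T (sym (lookup-replicate i true)) _

-- Agreements inside a vertex set

∑²-symmetrize : ∀ {m} f → ∑² m m (λ i j → f i j + f j i) ≡ ∑² m m f + ∑² m m f
∑²-symmetrize {m} f = trans (∑²-distrib-+ {m} {m} f (λ i j → f j i))
  (cong (∑² m m f +_) (∑-comm (allFin m) (allFin m) (λ i j → f j i)))

∑²-product : ∀ {m} f g → ∑² m m (λ i j → f i * g j) ≡ ∑ (allFin m) f * ∑ (allFin m) g
∑²-product {m} f g = trans (∑-cong (allFin m) (λ i → sym (*-distribˡ-∑ (allFin m) (f i) g)))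
                           (sym (*-distribʳ-∑ (allFin m) (∑ (allFin m) g) f))

module _ {m : ℕ} where

  pairs : Vec Bool m → Fin m → Fin m → Bool
  pairs W i j = (lookup W i ∧ lookup W j) ∧ does (i Fin.<? j)

  exclusive : ∀ (i j : Fin m) x y → 𝟙 (does (i Fin.<? j) ∧ x) + 𝟙 (does (j Fin.<? i) ∧ y) ≤ 1
  exclusive i j x y with toℕ i <ᵇ toℕ j in i<j | toℕ j <ᵇ toℕ i in j<i
  ... | true  | true  = contradiction (<ᵇ⇒< (toℕ i) _ (subst T (sym i<j) _))
                                      (<-asym (<ᵇ⇒< (toℕ j) _ (subst T (sym j<i) _)))
  ... | false | false = z≤n
  ... | false | true  = 𝟙≤1 y
  ... | true  | false = ≤-trans (≤-reflexive (+-identityʳ _)) (𝟙≤1 x)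

  -- Doubling counts ordered pairs of W × W, each at most once because i < j and j < i exclude each
  -- other.
  2*size-pairs : ∀ W → size (pairs W) + size (pairs W) ≤ ∣ W ∣ * ∣ W ∣
  2*size-pairs W = begin
    size (pairs W) + size (pairs W)
      ≡⟨ sym (∑²-symmetrize (λ i j → 𝟙 (pairs W i j))) ⟩
    ∑² m m (λ i j → 𝟙 (pairs W i j) + 𝟙 (pairs W j i))
      ≤⟨ ∑²-mono {m} {m} (λ i j → bound (lookup W i) (lookup W j) i j) ⟩
    ∑² m m (λ i j → member W i * member W j)
      ≡⟨ ∑²-product (member W) (member W) ⟩
    ∣ W ∣ * ∣ W ∣ ∎
    where
    open ≤-Reasoning
    strip : ∀ b → b ∧ true ≡ b
    strip true  = refl
    strip false = refl
    bound : ∀ a b (i j : Fin m) → 𝟙 ((a ∧ b) ∧ does (i Fin.<? j)) + 𝟙 ((b ∧ a) ∧ does (j Fin.<? i)) ≤ 𝟙 a * 𝟙 b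
    bound true  true  i j = subst₂ (λ x y → 𝟙 x + 𝟙 y ≤ 1) (strip (does (i Fin.<? j))) (strip (does (j Fin.<? i))) (exclusive i j true true)
    bound true  false i j = z≤n
    bound false true  i j = z≤n
    bound false false i j = z≤n

module _ {r m : ℕ} where

  forward : Matrix r m m → Matrix r m m → Graph {m}
  forward ψ χ i j = 𝟙 (does (i Fin.<? j) ∧ does (ψ ⟨ i , j ⟩ Fin.≟ χ ⟨ i , j ⟩))

  agreementGraph : Matrix r m m → Matrix r m m → Graph {m}
  agreementGraph ψ χ i j = forward ψ χ i j + forward ψ χ j i

  module _ (ψ χ : Matrix r m m) where
    private
      G = agreementGraph ψ χ

    agreementGraph-sym : ∀ i j → G i j ≡ G j i
    agreementGraph-sym i j = +-comm (forward ψ χ i j) (forward ψ χ j i)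

    agreement-adjacent : ∀ {i j} → i <ᶠ j → ψ ⟨ i , j ⟩ ≡ χ ⟨ i , j ⟩ → G i j ≢ 0
    agreement-adjacent {i} {j} i<j eq
      with toℕ i <ᵇ toℕ j | <⇒<ᵇ i<j | does (ψ ⟨ i , j ⟩ Fin.≟ χ ⟨ i , j ⟩) | dec-true (ψ ⟨ i , j ⟩ Fin.≟ χ ⟨ i , j ⟩) eq
    ... | true | _ | true | _ = λ ()

    handshake : ∀ W → ∑ (allFin m) (λ i → member W i * degree G W i)
                      ≡ agreement (pairs W) ψ χ + agreement (pairs W) ψ χ
    handshake W = trans
      (∑-cong (allFin m) (λ i → trans (*-distribˡ-∑ (allFin m) (member W i) _)
        (∑-cong (allFin m) (λ j → trans (expand (member W i) (member W j) _ _)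
          (cong₂ _+_ (factor (lookup W i) (lookup W j) _ _)
            (trans (cong (_* 𝟙 (does (j Fin.<? i) ∧ does (ψ ⟨ j , i ⟩ Fin.≟ χ ⟨ j , i ⟩))) (*-comm (member W i) (member W j)))
                   (factor (lookup W j) (lookup W i) _ _)))))))
      (∑²-symmetrize (agrees (pairs W) ψ χ))
      where
      expand : ∀ a b c d → a * (b * (c + d)) ≡ a * b * c + a * b * d
      expand = solve-∀
      factor : ∀ a b c d → 𝟙 a * 𝟙 b * 𝟙 (c ∧ d) ≡ 𝟙 (((a ∧ b) ∧ c) ∧ d)
      factor true  true  c d = *-identityˡ _
      factor true  false c d = refl
      factor false b     c d = refl

    -- A vertex has at most one edge to each member of W, so its degree bounds |W| from below; the
    -- edge count is the handshake lemma, halved and rounded up.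
    crowded : ∀ s W {i} → T (lookup W i) → (∀ i → T (lookup W i) → s ≤ degree G W i) →
      s ≤ ∣ W ∣ × ⌈ ∣ W ∣ * s /2⌉ ≤ agreement (pairs W) ψ χ
    crowded s W {i} i∈W deg≥s = ≤-trans (deg≥s i i∈W) (∑-mono (allFin m) λ j →
        ≤-trans (*-monoʳ-≤ (member W j) (exclusive i j _ _)) (≤-reflexive (*-identityʳ _)))
      , subst (⌈ ∣ W ∣ * s /2⌉ ≤_) (sym (n≡⌈n+n/2⌉ _)) (⌈n/2⌉-mono (begin
        ∣ W ∣ * s
          ≡⟨ *-distribʳ-∑ (allFin m) s (member W) ⟩
        ∑ (allFin m) (λ i → member W i * s)
          ≤⟨ ∑-mono (allFin m) (λ i → deg (lookup W i) (deg≥s i)) ⟩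
        ∑ (allFin m) (λ i → member W i * degree G W i)
          ≡⟨ handshake W ⟩
        agreement (pairs W) ψ χ + agreement (pairs W) ψ χ ∎))
      where
      open ≤-Reasoning
      deg : ∀ b {x} → (T b → s ≤ x) → 𝟙 b * s ≤ 𝟙 b * x
      deg true  s≤x = *-monoʳ-≤ 1 (s≤x _)
      deg false _   = z≤n

-- Union bound over vertex sets

subsets : ∀ m → List (Vec Bool m)
subsets = words (true ∷ false ∷ [])

∈-subsets : ∀ {m} (W : Vec Bool m) → W ∈ subsets m
∈-subsets = ∈-words λ { true → here refl ; false → there (here refl) }

-- The numbers of pairs and of edges in W are about |W|²/2 and |W| r/2; squaring the tail bound
-- clears these halves from the exponents. The result is X² C² ≤ N².
√-bound : ∀ {X C N Q H K D E} .{{_ : NonZero Q}} .{{_ : NonZero K}} →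
  C * (Q * K) ≤ H * (N * D) → D * D ≤ E * (K * K) → X * X * (E * (H * H)) ≤ Q * Q → X * C ≤ N
√-bound {X} {C} {N} {Q} {H} {K} {D} {E} tail growth rare =
  ^-cancelʳ-≤ 2 (*-cancelʳ-≤ _ _ (Q * K * (Q * K)) {{m*n≢0 (Q * K) (Q * K) {{QK≢0}} {{QK≢0}}}} (begin
    (X * C) ^ 2 * (Q * K * (Q * K))               ≡⟨ square X C (Q * K) ⟩
    X * X * (C * (Q * K) * (C * (Q * K)))         ≤⟨ *-monoʳ-≤ (X * X) (*-mono-≤ tail tail) ⟩
    X * X * (H * (N * D) * (H * (N * D)))         ≡⟨ regroup (X * X) H N D ⟩
    X * X * (H * H) * (N * N) * (D * D)           ≤⟨ *-monoʳ-≤ (X * X * (H * H) * (N * N)) growth ⟩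
    X * X * (H * H) * (N * N) * (E * (K * K))     ≡⟨ regroup₂ (X * X) (H * H) (N * N) E (K * K) ⟩
    X * X * (E * (H * H)) * (N * N * (K * K))     ≤⟨ *-monoˡ-≤ (N * N * (K * K)) rare ⟩
    Q * Q * (N * N * (K * K))                     ≡⟨ regroup₃ Q N K ⟩
    N ^ 2 * (Q * K * (Q * K))                     ∎))
  where
  open ≤-Reasoning
  QK≢0 : NonZero (Q * K)
  QK≢0 = m*n≢0 Q K
  square : ∀ x c p → x * c * (x * c * 1) * (p * p) ≡ x * x * (c * p * (c * p))
  square = solve-∀
  regroup : ∀ a b c d → a * (b * (c * d) * (b * (c * d))) ≡ a * (b * b) * (c * c) * (d * d)
  regroup = solve-∀
  regroup₂ : ∀ a b c d e → a * b * c * (d * e) ≡ a * (d * b) * (c * e)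
  regroup₂ = solve-∀
  regroup₃ : ∀ q c z → q * q * (c * c * (z * z)) ≡ c * (c * 1) * (q * z * (q * z))
  regroup₃ = solve-∀

-- The squared union bound for sets of size k: n from the greedy choice, 2 ^ m vertex sets, a spare
-- factor 2, and 4 ^ (r k) ≥ (1 + r/k) ^ (2 f) for f ≤ k²/2 pairs.
CrowdedIsRare : ℕ → ℕ → ℕ → Set
CrowdedIsRare r m n = ∀ k → r ≤ k → k ≤ m → let h = ⌈ k * r /2⌉ in
  n * 2 ^ suc m * (n * 2 ^ suc m) * (4 ^ (r * k) * (k ^ h * k ^ h)) ≤ (r * r) ^ h * (r * r) ^ h

module RandomFamily (r₁ m n : ℕ) (m≤r² : m ≤ suc r₁ * suc r₁) (rare : CrowdedIsRare (suc r₁) m n) where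

  r : ℕ
  r = suc r₁

  Ψ : List (Matrix r m m)
  Ψ = matrices r m m

  N X : ℕ
  N = (r ^ m) ^ m
  X = n * 2 ^ suc m

  instance
    N≢0 : NonZero N
    N≢0 = m^n≢0 (r ^ m) m {{m^n≢0 r m}}

  -- The first factor drops sets smaller than r: they cannot induce minimum degree r, and `rare`
  -- covers only k ≥ r.
  crowds : Vec Bool m → Matrix r m m → Matrix r m m → ℕ
  crowds W ψ χ = 𝟙 (r ≤ᵇ ∣ W ∣) * 𝟙 (⌈ ∣ W ∣ * r /2⌉ ≤ᵇ agreement (pairs W) ψ χ)

  bad : Matrix r m m → Matrix r m m → ℕ
  bad ψ χ = ∑ (subsets m) (λ W → crowds W ψ χ)

  few-crowded : ∀ W χ → X * ∑ Ψ (λ ψ → crowds W ψ χ) ≤ N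
  few-crowded W χ with r ≤ᵇ ∣ W ∣ in eq
  ... | false = ≤-trans (≤-reflexive (trans (cong (X *_) (trans (∑-const Ψ 0) (*-zeroʳ (length Ψ)))) (*-zeroʳ X))) z≤n
  ... | true  = ≤-trans (≤-reflexive (cong (X *_) (∑-cong Ψ (λ ψ → *-identityˡ _))))
    (√-bound {X} {C} {N} {(r * r) ^ h} {k ^ h} {k ^ f} {(k + r) ^ f} {4 ^ (r * k)}
      {{m^n≢0 (r * r) h}} {{m^n≢0 k f}} tail growth (rare k r≤k k≤m))
    where
    k h f C : ℕ
    k = ∣ W ∣
    h = ⌈ k * r /2⌉
    f = size (pairs W)
    C = ∑ Ψ (λ ψ → 𝟙 (h ≤ᵇ agreement (pairs W) ψ χ))
    r≤k : r ≤ k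
    r≤k = ≤ᵇ⇒≤ r k (subst T (sym eq) _)
    k≤m : k ≤ m
    k≤m = ≤-trans (∑-mono (allFin m) (λ i → 𝟙≤1 (lookup W i)))
      (≤-reflexive (trans (∑-const (allFin m) 1) (trans (*-identityʳ _) (length-allFin m))))
    instance
      k≢0 : NonZero k
      k≢0 = >-nonZero (≤-trans z<s r≤k)
    -- With the weights k and r an agreement weighs r²/k times a disagreement, about the ratio of
    -- the threshold k r/2 to the expected k²/(2r) agreements.
    tail : C * ((r * r) ^ h * k ^ f) ≤ k ^ h * (N * (k + r) ^ f)
    tail = chernoff (pairs W) χ h k r (≤-trans k≤m m≤r²)
    growth : (k + r) ^ f * (k + r) ^ f ≤ 4 ^ (r * k) * (k ^ f * k ^ f)
    growth = subst₂ (λ x y → x ≤ 4 ^ (r * k) * y) (^-distribˡ-+-* (k + r) f f) (^-distribˡ-+-* k f f)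
      ([b+s]^c≤4^sk*b^c k r k (2*size-pairs W))

  -- Each of the 2 ^ m sets contributes at most N / X; the spare factor 2 in X makes the inequality
  -- strict.
  few-bad : ∀ χ → n * ∑ Ψ (λ ψ → bad ψ χ) < N
  few-bad χ = ≰⇒> λ N≤ → contradiction (*-cancelˡ-≤ (2 ^ m) {{m^n≢0 2 m}} (begin
    2 ^ m * (2 * N)                           ≤⟨ *-monoʳ-≤ (2 ^ m) (*-monoʳ-≤ 2 N≤) ⟩
    2 ^ m * (2 * (n * B))                     ≡⟨ regroup (2 ^ m) n B ⟩
    X * B                                     ≡⟨ cong (X *_) (∑-comm Ψ (subsets m) (λ ψ W → crowds W ψ χ)) ⟩
    X * ∑ (subsets m) (λ W → ∑ Ψ (λ ψ → crowds W ψ χ))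
                                              ≡⟨ *-distribˡ-∑ (subsets m) X _ ⟩
    ∑ (subsets m) (λ W → X * ∑ Ψ (λ ψ → crowds W ψ χ))
                                              ≤⟨ ∑-mono (subsets m) (λ W → few-crowded W χ) ⟩
    ∑ (subsets m) (λ _ → N)                   ≡⟨ trans (∑-const (subsets m) N) (cong (_* N) (length-words (true ∷ false ∷ []) m)) ⟩
    2 ^ m * N                                 ∎))
    (<⇒≱ (m<m+n N (≤-trans (>-nonZero⁻¹ N) (m≤m+n N 0))))
    where
    open ≤-Reasoning
    B = ∑ Ψ (λ ψ → bad ψ χ)
    regroup : ∀ a b c → a * (2 * (b * c)) ≡ b * (2 * a) * c
    regroup = solve-∀

  good⇒degenerate : ∀ ψ χ → bad ψ χ ≡ 0 → Degenerate r (agreementGraph ψ χ)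
  good⇒degenerate ψ χ good W (i , i∈W)
    with Fin.any? (λ i → T? (lookup W i) ×-dec (degree (agreementGraph ψ χ) W i <? r))
  ... | yes low = low
  ... | no ¬low with crowded ψ χ r W i∈W (λ j j∈W → ≮⇒≥ λ low → ¬low (j , j∈W , low))
  ... | r≤k , h≤A = contradiction (∑≡0⇒≡0 (λ W → crowds W ψ χ) good (∈-subsets W))
    λ eq → both _ _ (≤⇒≤ᵇ r≤k) (≤⇒≤ᵇ h≤A) eq
    where
    both : ∀ a b → T a → T b → 𝟙 a * 𝟙 b ≢ 0
    both true true _ _ ()

  family : Family (suc n) m r
  family = record
    { χ = λ a i j → ψ a ⟨ i , j ⟩
    ; κ = λ a b → paint (a Fin.<? b)
    ; proper = λ {a} {b} → proper′ (a Fin.<? b)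
    }
    where
    chosen = greedy Ψ bad n
      (subst (0 <_) (sym (length-matrices r m m)) (>-nonZero⁻¹ N))
      (λ χ → subst (n * ∑ Ψ (λ ψ → bad ψ χ) <_) (sym (length-matrices r m m)) (few-bad χ))
    ψ : Fin (suc n) → Matrix r m m
    ψ = proj₁ chosen
    colored : ∀ {a b} → a <ᶠ b → Σ (Fin m → Fin r) λ κ →
      (∀ {i j} → i ≢ j → agreementGraph (ψ a) (ψ b) i j ≢ 0 → κ i ≢ κ j)
    colored {a} {b} a<b = degenerate⇒colorable _ (agreementGraph-sym (ψ a) (ψ b))
      (good⇒degenerate (ψ a) (ψ b) (proj₂ chosen a<b))
    paint : ∀ {a b} → Dec (a <ᶠ b) → Fin m → Fin r
    paint (yes a<b) = proj₁ (colored a<b)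
    paint (no _)    = λ _ → zero
    proper′ : ∀ {a b i j} (a<?b : Dec (a <ᶠ b)) → a <ᶠ b → i <ᶠ j → ψ a ⟨ i , j ⟩ ≡ ψ b ⟨ i , j ⟩ →
      paint a<?b i ≢ paint a<?b j
    proper′ {a} {b} (yes p) a<b i<j eq = proj₂ (colored p) (Fin.<⇒≢ i<j) (agreement-adjacent (ψ a) (ψ b) i<j eq)
    proper′ {a} {b} (no ¬p) a<b i<j eq = contradiction a<b ¬p

-- Numerical estimates

-- Equality holds at k = r. With j = k - r, k ^ r ≤ 4 ^ j * r ^ r, so each further unit of k costs
-- at most 16 k ≤ r².
r^r*[4k]^k≤4^r*[r*r]^k : ∀ r k → r ≤ k → 16 * k ≤ r * r → r ^ r * (4 * k) ^ k ≤ 4 ^ r * (r * r) ^ k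
r^r*[4k]^k≤4^r*[r*r]^k r k r≤k 16k≤r² = begin
  r ^ r * (4 * k) ^ k                          ≡⟨ cong (λ e → r ^ r * (4 * k) ^ e) k≡ ⟩
  r ^ r * (4 * k) ^ (r + j)                    ≡⟨ cong (r ^ r *_) (trans (^-distribˡ-+-* (4 * k) r j) (cong (_* (4 * k) ^ j) ([m*n]^o 4 k r))) ⟩
  r ^ r * (4 ^ r * k ^ r * (4 * k) ^ j)        ≤⟨ *-monoʳ-≤ (r ^ r) (*-monoˡ-≤ ((4 * k) ^ j) (*-monoʳ-≤ (4 ^ r)
                                                    (subst (λ z → z ^ r ≤ 4 ^ j * r ^ r) (sym k≡) ([b+s]^b≤4^s*b^b r j ≤-refl)))) ⟩
  r ^ r * (4 ^ r * (4 ^ j * r ^ r) * (4 * k) ^ j)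
                                               ≡⟨ regroup (r ^ r) (4 ^ r) (4 ^ j) ((4 * k) ^ j) ⟩
  4 ^ r * (r ^ r * r ^ r * (4 ^ j * (4 * k) ^ j))
                                               ≡⟨ cong₂ (λ x y → 4 ^ r * (x * y)) (sym ([m*n]^o r r r)) (trans (sym ([m*n]^o 4 (4 * k) j)) (cong (_^ j) (sym (*-assoc 4 4 k)))) ⟩
  4 ^ r * ((r * r) ^ r * (16 * k) ^ j)         ≤⟨ *-monoʳ-≤ (4 ^ r) (*-monoʳ-≤ ((r * r) ^ r) (^-monoˡ-≤ j 16k≤r²)) ⟩
  4 ^ r * ((r * r) ^ r * (r * r) ^ j)          ≡⟨ cong (4 ^ r *_) (trans (sym (^-distribˡ-+-* (r * r) r j)) (cong ((r * r) ^_) (sym k≡))) ⟩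
  4 ^ r * (r * r) ^ k                          ∎
  where
  open ≤-Reasoning
  j = k ∸ r
  k≡ : k ≡ r + j
  k≡ = sym (m+[n∸m]≡n r≤k)
  regroup : ∀ a b c d → a * (b * (c * a) * d) ≡ b * (a * a * (c * d))
  regroup = solve-∀

-- Since 4 · 16⁴ < 25⁴, the slack (25/16) ^ E pays for the squared number of vertex sets once E ≥ 4
-- m.
4^m*16^E≤25^E : ∀ m E → 4 * m ≤ E → 4 ^ m * 16 ^ E ≤ 25 ^ E
4^m*16^E≤25^E m E 4m≤E = begin
  4 ^ m * 16 ^ E                       ≡⟨ cong (4 ^ m *_) (split 16) ⟩
  4 ^ m * ((16 ^ 4) ^ m * 16 ^ w)      ≡⟨ trans (sym (*-assoc (4 ^ m) _ _)) (cong (_* 16 ^ w) (sym ([m*n]^o 4 (16 ^ 4) m))) ⟩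
  (4 * 16 ^ 4) ^ m * 16 ^ w            ≤⟨ *-mono-≤ (^-monoˡ-≤ m (≤ᵇ⇒≤ (4 * 16 ^ 4) (25 ^ 4) _)) (^-monoˡ-≤ w (≤ᵇ⇒≤ 16 25 _)) ⟩
  (25 ^ 4) ^ m * 25 ^ w                ≡⟨ sym (split 25) ⟩
  25 ^ E                               ∎
  where
  open ≤-Reasoning
  w = E ∸ 4 * m
  split : ∀ b → b ^ E ≡ (b ^ 4) ^ m * b ^ w
  split b = trans (cong (b ^_) (sym (m+[n∸m]≡n 4m≤E)))
    (trans (^-distribˡ-+-* b (4 * m) w) (cong (_* b ^ w) (sym (^-*-assoc b 4 m))))

-- The last hypothesis is n ≤ r ^ (r²/2) / (5/2) ^ (r²), squared. One factor 4 ^ E comes from it,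
-- another from the r-th power of `r^r*[4k]^k≤4^r*[r*r]^k`; together with 4 ^ (m + 1) they are
-- absorbed by 25 ^ E.
random-rare : ∀ r m n → 4 ≤ r → 16 * m ≤ r * r → n * n * 25 ^ (r * r) ≤ 4 ^ (r * r) * r ^ (r * r) →
  CrowdedIsRare r m n
random-rare r m n 4≤r 16m≤r² n-small k r≤k k≤m = begin
  X * X * (4 ^ (r * k) * (k ^ h * k ^ h))            ≡⟨ cong (λ e → X * X * (4 ^ (r * k) * e)) (double k) ⟩
  X * X * (4 ^ (r * k) * (k ^ (k * r) * k ^ z))      ≡⟨ assoc (X * X) (4 ^ (r * k)) (k ^ (k * r)) (k ^ z) ⟩
  X * X * (4 ^ (r * k) * k ^ (k * r)) * k ^ z        ≤⟨ *-mono-≤ main (^-monoˡ-≤ z k≤Q) ⟩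
  Q ^ (k * r) * Q ^ z                                ≡⟨ sym (double Q) ⟩
  Q ^ h * Q ^ h                                      ∎
  where
  open ≤-Reasoning
  X = n * 2 ^ suc m
  Q = r * r
  E = r * r
  h = ⌈ k * r /2⌉
  -- The effect of rounding h up, 0 or 1; harmless because k ≤ Q.
  z = h + h ∸ k * r
  instance
    r≢0 : NonZero r
    r≢0 = >-nonZero (≤-trans z<s 4≤r)
  kr≤2h : k * r ≤ h + h
  kr≤2h = subst (_≤ h + h) (⌊n/2⌋+⌈n/2⌉≡n (k * r)) (+-monoˡ-≤ h (⌊n/2⌋≤⌈n/2⌉ (k * r)))
  double : ∀ b → b ^ h * b ^ h ≡ b ^ (k * r) * b ^ z
  double b = trans (sym (^-distribˡ-+-* b h h)) (trans (cong (b ^_) (sym (m+[n∸m]≡n kr≤2h))) (^-distribˡ-+-* b (k * r) z))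
  16k≤Q : 16 * k ≤ Q
  16k≤Q = ≤-trans (*-monoʳ-≤ 16 k≤m) 16m≤r²
  k≤Q : k ≤ Q
  k≤Q = ≤-trans (m≤n*m k 16) 16k≤Q
  4[1+m]≤E : 4 * suc m ≤ E
  4[1+m]≤E = *-cancelˡ-≤ 2 (begin
    2 * (4 * suc m)       ≡⟨ expand m ⟩
    8 + 8 * m             ≤⟨ +-mono-≤ (≤ᵇ⇒≤ 8 16 _) (*-monoˡ-≤ m (≤ᵇ⇒≤ 8 16 _)) ⟩
    16 + 16 * m           ≤⟨ +-mono-≤ (*-mono-≤ 4≤r 4≤r) (≤-trans 16m≤r² (m≤m+n E 0)) ⟩
    2 * E                 ∎)
    where
    expand : ∀ m → 2 * (4 * suc m) ≡ 8 + 8 * m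
    expand = solve-∀
  assoc : ∀ a b c d → a * (b * (c * d)) ≡ a * (b * c) * d
  assoc = solve-∀
  regroup₁ : ∀ n p a b e → n * p * (n * p) * (a * b) * e ≡ n * n * e * (p * p * (a * b))
  regroup₁ = solve-∀
  regroup₂ : ∀ a b c d → a * b * (c * d) ≡ c * a * (b * d)
  regroup₂ = solve-∀
  regroup₃ : ∀ a b c d → a * b * (c * d) ≡ a * (b * c) * d
  regroup₃ = solve-∀
  main : X * X * (4 ^ (r * k) * k ^ (k * r)) ≤ Q ^ (k * r)
  main = *-cancelʳ-≤ _ _ (25 ^ E) {{m^n≢0 25 E}} (begin
    X * X * (4 ^ (r * k) * k ^ (k * r)) * 25 ^ E
      ≡⟨ regroup₁ n (2 ^ suc m) (4 ^ (r * k)) (k ^ (k * r)) (25 ^ E) ⟩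
    n * n * 25 ^ E * (2 ^ suc m * 2 ^ suc m * (4 ^ (r * k) * k ^ (k * r)))
      ≤⟨ *-monoˡ-≤ _ n-small ⟩
    4 ^ E * r ^ E * (2 ^ suc m * 2 ^ suc m * (4 ^ (r * k) * k ^ (k * r)))
      ≡⟨ cong₂ (λ x y → 4 ^ E * r ^ E * (x * y)) (sym ([m*n]^o 2 2 (suc m)))
           (trans (cong (λ e → 4 ^ e * k ^ (k * r)) (*-comm r k)) (sym ([m*n]^o 4 k (k * r)))) ⟩
    4 ^ E * r ^ E * (4 ^ suc m * (4 * k) ^ (k * r))
      ≡⟨ regroup₂ (4 ^ E) (r ^ E) (4 ^ suc m) ((4 * k) ^ (k * r)) ⟩
    4 ^ suc m * 4 ^ E * (r ^ E * (4 * k) ^ (k * r))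
      ≡⟨ cong (4 ^ suc m * 4 ^ E *_) (sym (trans ([m*n]^o (r ^ r) ((4 * k) ^ k) r) (cong₂ _*_ (^-*-assoc r r r) (^-*-assoc (4 * k) k r)))) ⟩
    4 ^ suc m * 4 ^ E * (r ^ r * (4 * k) ^ k) ^ r
      ≤⟨ *-monoʳ-≤ (4 ^ suc m * 4 ^ E) (^-monoˡ-≤ r (r^r*[4k]^k≤4^r*[r*r]^k r k r≤k 16k≤Q)) ⟩
    4 ^ suc m * 4 ^ E * (4 ^ r * Q ^ k) ^ r
      ≡⟨ cong (4 ^ suc m * 4 ^ E *_) (trans ([m*n]^o (4 ^ r) (Q ^ k) r) (cong₂ _*_ (^-*-assoc 4 r r) (^-*-assoc Q k r))) ⟩
    4 ^ suc m * 4 ^ E * (4 ^ E * Q ^ (k * r))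
      ≡⟨ trans (regroup₃ (4 ^ suc m) (4 ^ E) (4 ^ E) (Q ^ (k * r))) (cong (λ e → 4 ^ suc m * e * Q ^ (k * r)) (sym ([m*n]^o 4 4 E))) ⟩
    4 ^ suc m * 16 ^ E * Q ^ (k * r)
      ≤⟨ *-monoˡ-≤ (Q ^ (k * r)) (4^m*16^E≤25^E (suc m) E 4[1+m]≤E) ⟩
    25 ^ E * Q ^ (k * r)
      ≡⟨ *-comm (25 ^ E) _ ⟩
    Q ^ (k * r) * 25 ^ E ∎)

random-colorable : ∀ r m n n′ → 4 ≤ r → 16 * m ≤ r * r → n ≤ suc n′ →
  n′ * n′ * 25 ^ (r * r) ≤ 4 ^ (r * r) * r ^ (r * r) → Colorable m n r
random-colorable r@(suc r₁) m n n′ 4≤r 16m≤r² n≤ n-small = family⇒colorableᵀ (restrict n≤ ≤-refl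
  (RandomFamily.family r₁ m n′ (≤-trans (m≤n*m m 16) 16m≤r²) (random-rare r m n′ 4≤r 16m≤r² n-small)))

binary-length : ∀ r .{{_ : NonZero r}} → ∃[ l ] (2 ^ l ≤ r × r < 2 ^ suc l)
binary-length (suc zero)      = 0 , ≤-refl , ≤-refl
binary-length (suc r@(suc _)) with binary-length r
... | l , 2^l≤r , r<2^1+l with suc r <? 2 ^ suc l
... | yes 1+r< = l , m≤n⇒m≤1+n 2^l≤r , 1+r<
... | no  1+r≮ = suc l , ≮⇒≥ 1+r≮ , ≤-<-trans r<2^1+l (^-monoʳ-< 2 ≤-refl (n<1+n (suc l)))

code-colorable : ∀ r t l m n n′ → 2 ^ l ≤ r → n ≤ suc m → n′ ≤ 2 ^ t →
  t < suc l ⊎ m * (4 * t) ^ suc l < (r * suc l) ^ suc l → Colorable n n′ r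
code-colorable r t l m n n′ 2^l≤r n≤ n′≤ h = family⇒colorable (restrict n≤ n′≤ (codeFamily r t l m 2^l≤r h))

-- Squared and stripped of the exponent L, the claim is 16 t² (2 + k) < P². For t = P/(2k) this is 4
-- (k + 2) < k², true from k = 6 on. Rounding t up costs a factor of at most 33/32 if P ≥ 64 k, and
-- 4 (33/32)² = 1089/256 is still small enough.
code-bound₁ : ∀ k P t L m .{{_ : NonZero L}} → 6 ≤ k → 64 * k ≤ P → 2 * k * t ≤ P + 2 * k →
  m * m ≤ (2 + k) ^ L → m * (4 * t) ^ L < P ^ L
code-bound₁ k P t L m 6≤k 64k≤P 2kt≤ m²≤ = ^-cancelʳ-< 2 (begin-strict
  (m * (4 * t) ^ L) ^ 2                          ≡⟨ square m ((4 * t) ^ L) ⟩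
  m * m * ((4 * t) ^ L * (4 * t) ^ L)            ≤⟨ *-monoˡ-≤ _ m²≤ ⟩
  (2 + k) ^ L * ((4 * t) ^ L * (4 * t) ^ L)      ≡⟨ sym (trans ([m*n]^o (2 + k) (4 * t * (4 * t)) L) (cong ((2 + k) ^ L *_) ([m*n]^o (4 * t) (4 * t) L))) ⟩
  ((2 + k) * (4 * t * (4 * t))) ^ L              <⟨ ^-monoˡ-< L base ⟩
  (P * P) ^ L                                    ≡⟨ trans ([m*n]^o P P L) (cong (P ^ L *_) (sym (*-identityʳ (P ^ L)))) ⟩
  (P ^ L) ^ 2                                    ∎)
  where
  open ≤-Reasoning
  square : ∀ x y → x * y * (x * y * 1) ≡ x * x * (y * y)
  square = solve-∀
  instance
    k≢0 : NonZero k
    k≢0 = >-nonZero (≤-trans z<s 6≤k)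
    P≢0 : NonZero P
    P≢0 = >-nonZero (≤-trans (*-mono-≤ {1} {64} (s≤s z≤n) (≤-trans z<s 6≤k)) 64k≤P)
  64tk≤33P : 64 * t * k ≤ 33 * P
  64tk≤33P = begin
    64 * t * k              ≡⟨ e₁ t k ⟩
    32 * (2 * k * t)        ≤⟨ *-monoʳ-≤ 32 2kt≤ ⟩
    32 * (P + 2 * k)        ≡⟨ e₂ P k ⟩
    32 * P + 64 * k         ≤⟨ +-monoʳ-≤ (32 * P) 64k≤P ⟩
    32 * P + P              ≡⟨ e₃ P ⟩
    33 * P                  ∎
    where
    e₁ : ∀ t k → 64 * t * k ≡ 32 * (2 * k * t)
    e₁ = solve-∀
    e₂ : ∀ P k → 32 * (P + 2 * k) ≡ 32 * P + 64 * k
    e₂ = solve-∀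
    e₃ : ∀ P → 32 * P + P ≡ 33 * P
    e₃ = solve-∀
  1089[2+k]<256k² : 1089 * (2 + k) < 256 * (k * k)
  1089[2+k]<256k² = begin-strict
    1089 * (2 + k)          ≡⟨ e₁ k ⟩
    -- 447 = 6 · 256 - 1089, and 2682 = 6 · 447.
    2178 + 1089 * k         <⟨ +-monoˡ-< (1089 * k) (≤ᵇ⇒≤ 2179 2682 _) ⟩
    2682 + 1089 * k         ≤⟨ +-monoˡ-≤ (1089 * k) (*-monoʳ-≤ 447 6≤k) ⟩
    447 * k + 1089 * k      ≡⟨ e₂ k ⟩
    256 * (6 * k)           ≤⟨ *-monoʳ-≤ 256 (*-monoˡ-≤ k 6≤k) ⟩
    256 * (k * k)           ∎
    where
    e₁ : ∀ k → 1089 * (2 + k) ≡ 2178 + 1089 * k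
    e₁ = solve-∀
    e₂ : ∀ k → 447 * k + 1089 * k ≡ 256 * (6 * k)
    e₂ = solve-∀
  base : (2 + k) * (4 * t * (4 * t)) < P * P
  base = *-cancelʳ-< (256 * (k * k)) _ _ (begin-strict
    (2 + k) * (4 * t * (4 * t)) * (256 * (k * k))      ≡⟨ e₁ (2 + k) t k ⟩
    (2 + k) * (64 * t * k * (64 * t * k))              ≤⟨ *-monoʳ-≤ (2 + k) (*-mono-≤ 64tk≤33P 64tk≤33P) ⟩
    (2 + k) * (33 * P * (33 * P))                      ≡⟨ e₂ (2 + k) P ⟩
    P * P * (1089 * (2 + k))                           <⟨ *-monoʳ-< (P * P) {{m*n≢0 P P}} 1089[2+k]<256k² ⟩
    P * P * (256 * (k * k))                            ∎)
    where
    e₁ : ∀ a t k → a * (4 * t * (4 * t)) * (256 * (k * k)) ≡ a * (64 * t * k * (64 * t * k))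
    e₁ = solve-∀
    e₂ : ∀ a P → a * (33 * P * (33 * P)) ≡ P * P * (1089 * a)
    e₂ = solve-∀

-- With a = u / v the hypotheses read m ≤ r ^ (a L) and t ≤ r ^ (1 - a), so m t ^ L ≤ r ^ L. What
-- remains is 4 (t + 1) ≤ 8 t, and L > 8 beats the 8.
code-bound₂ : ∀ r t L m u v .{{_ : NonZero r}} .{{_ : NonZero v}} → 8 < L →
  m ^ v ≤ r ^ (u * L) → t ^ v * r ^ u ≤ r ^ v →
  suc t < L ⊎ m * (4 * suc t) ^ L < (r * L) ^ L
code-bound₂ r zero    L m u v 8<L mᵛ≤ tᵛ≤ = inj₁ (≤-trans (s≤s (s≤s z≤n)) 8<L)
code-bound₂ r t@(suc t₁) L m u v 8<L mᵛ≤ tᵛ≤ = inj₂ (begin-strict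
  m * (4 * suc t) ^ L         ≤⟨ *-monoʳ-≤ m (^-monoˡ-≤ L 4[1+t]≤) ⟩
  m * (8 * t) ^ L             ≡⟨ trans (cong (m *_) ([m*n]^o 8 t L)) (swap m (8 ^ L) (t ^ L)) ⟩
  8 ^ L * (m * t ^ L)         ≤⟨ *-monoʳ-≤ (8 ^ L) (^-cancelʳ-≤ v (*-cancelʳ-≤ _ _ (r ^ (u * L)) {{m^n≢0 r (u * L)}} powers)) ⟩
  8 ^ L * r ^ L               ≡⟨ trans (*-comm (8 ^ L) (r ^ L)) (sym ([m*n]^o r 8 L)) ⟩
  (r * 8) ^ L                 <⟨ ^-monoˡ-< L {{>-nonZero (≤-trans z<s 8<L)}} (*-monoʳ-< r 8<L) ⟩
  (r * L) ^ L                 ∎)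
  where
  open ≤-Reasoning
  swap : ∀ a b c → a * (b * c) ≡ b * (a * c)
  swap = solve-∀
  4[1+t]≤ : 4 * suc t ≤ 8 * t
  4[1+t]≤ = begin
    4 * suc t      ≡⟨ *-suc 4 t ⟩
    4 + 4 * t      ≤⟨ +-monoˡ-≤ (4 * t) (*-monoʳ-≤ 4 (s≤s (z≤n {t₁}))) ⟩
    4 * t + 4 * t  ≡⟨ sym (*-distribʳ-+ t 4 4) ⟩
    8 * t          ∎
  flip : ∀ b x y → (b ^ x) ^ y ≡ (b ^ y) ^ x
  flip b x y = trans (^-*-assoc b x y) (trans (cong (b ^_) (*-comm x y)) (sym (^-*-assoc b y x)))
  powers : (m * t ^ L) ^ v * r ^ (u * L) ≤ (r ^ L) ^ v * r ^ (u * L)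
  powers = begin
    (m * t ^ L) ^ v * r ^ (u * L)            ≡⟨ cong₂ _*_ (trans ([m*n]^o m (t ^ L) v) (cong (m ^ v *_) (flip t L v))) (sym (^-*-assoc r u L)) ⟩
    m ^ v * (t ^ v) ^ L * (r ^ u) ^ L        ≡⟨ trans (*-assoc (m ^ v) _ _) (cong (m ^ v *_) (sym ([m*n]^o (t ^ v) (r ^ u) L))) ⟩
    m ^ v * (t ^ v * r ^ u) ^ L              ≤⟨ *-mono-≤ mᵛ≤ (^-monoˡ-≤ L tᵛ≤) ⟩
    r ^ (u * L) * (r ^ v) ^ L                ≡⟨ trans (*-comm (r ^ (u * L)) _) (cong (_* r ^ (u * L)) (flip r v L)) ⟩
    (r ^ L) ^ v * r ^ (u * L)                ∎

-- Rational numbers as fractions of natural numbers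

open RawSemiringDefs ℚ.+-*-rawSemiring using () renaming (_^_ to _^ℚ_)

ι : ℕ → ℚ
ι n = ℤ.+ n ℚ./ 1

private
  ι′ : ℕ → ℚ
  ι′ n = mkℚ (ℤ.+ n) 0 (Coprimality.sym (Coprimality.1-coprimeTo n))

  ι≡ι′ : ∀ n → ι n ≡ ι′ n
  ι≡ι′ n = ℚ.normalize-coprime (Coprimality.sym (Coprimality.1-coprimeTo n))

ι-mono-< : ∀ {m n} → m < n → ι m ℚ.< ι n
ι-mono-< {m} {n} m<n = subst₂ ℚ._<_ (sym (ι≡ι′ m)) (sym (ι≡ι′ n))
  (*<* (subst₂ ℤ._<_ (sym (ℤ.*-identityʳ (ℤ.+ m))) (sym (ℤ.*-identityʳ (ℤ.+ n))) (ℤ.+<+ m<n)))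

ι-cancel-< : ∀ {m n} → ι m ℚ.< ι n → m < n
ι-cancel-< {m} {n} lt = ℤ.drop‿+<+ (subst₂ ℤ._<_ (ℤ.*-identityʳ (ℤ.+ m)) (ℤ.*-identityʳ (ℤ.+ n))
  (ℚ.drop-*<* (subst₂ ℚ._<_ (ι≡ι′ m) (ι≡ι′ n) lt)))

ι-* : ∀ m n → ι m ℚ.* ι n ≡ ι (m * n)
ι-* m n = trans (cong₂ ℚ._*_ (ι≡ι′ m) (ι≡ι′ n)) (cong (ℚ._/ 1) (sym (ℤ.pos-* m n)))

ι-+ : ∀ m n → ι m ℚ.+ ι n ≡ ι (m + n)
ι-+ m n = trans (cong₂ ℚ._+_ (ι≡ι′ m) (ι≡ι′ n))
  (cong (ℚ._/ 1) (trans (cong₂ ℤ._+_ (ℤ.*-identityʳ (ℤ.+ m)) (ℤ.*-identityʳ (ℤ.+ n))) (sym (ℤ.pos-+ m n))))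

numerator : ∀ p → p ℚ.* ι (↧ₙ p) ≡ ↥ p ℚ./ 1
numerator p@(mkℚ n d c) = begin
  p ℚ.* ι (suc d)                      ≡⟨ cong (p ℚ.*_) (ι≡ι′ (suc d)) ⟩
  fromℚᵘ (mkℚᵘ (n ℤ.* ℤ.+ suc d) (d * 1)) ≡⟨ ℚ.fromℚᵘ-cong {mkℚᵘ (n ℤ.* ℤ.+ suc d) (d * 1)} {mkℚᵘ n 0}
                                             (*≡* (trans (ℤ.*-identityʳ (n ℤ.* ℤ.+ suc d)) (cong (λ k → n ℤ.* ℤ.+ suc k) (sym (*-identityʳ d))))) ⟩
  n ℚ./ 1                              ∎
  where open ≡-Reasoning

-- The fraction x / y may be reducible, so that products and powers are formed entrywise, without
-- gcds.
record Frac (q : ℚ) (x y : ℕ) : Set where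
  constructor frac
  field
    0<den : 0 < y
    q*y≡x : q ℚ.* ι y ≡ ι x

open Frac

ι-positive : ∀ {y} → 0 < y → ℚ.Positive (ι y)
ι-positive 0<y = ℚ.positive (ι-mono-< 0<y)

frac-< : ∀ {p q x y x′ y′} → Frac p x y → Frac q x′ y′ → p ℚ.< q → x * y′ < x′ * y
frac-< {p} {q} {x} {y} {x′} {y′} (frac 0<y px) (frac 0<y′ qx) p<q = ι-cancel-< (subst₂ ℚ._<_
  (trans (cong (ℚ._* ι y′) px) (ι-* x y′))
  (trans (ℚ-swap q (ι y) (ι y′)) (trans (cong (ℚ._* ι y) qx) (ι-* x′ y)))
  (ℚ.*-monoˡ-<-pos (ι y′) {{ι-positive 0<y′}} (ℚ.*-monoˡ-<-pos (ι y) {{ι-positive 0<y}} p<q)))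

frac-<⁻¹ : ∀ {p q x y x′ y′} → Frac p x y → Frac q x′ y′ → x * y′ < x′ * y → p ℚ.< q
frac-<⁻¹ {p} {q} {x} {y} {x′} {y′} (frac 0<y px) (frac 0<y′ qx) lt =
  ℚ.*-cancelʳ-<-nonNeg (ι y) {{nonNeg 0<y}} (ℚ.*-cancelʳ-<-nonNeg (ι y′) {{nonNeg 0<y′}} (subst₂ ℚ._<_
    (trans (sym (ι-* x y′)) (cong (ℚ._* ι y′) (sym px)))
    (trans (sym (ι-* x′ y)) (trans (cong (ℚ._* ι y) (sym qx)) (ℚ-swap q (ι y′) (ι y))))
    (ι-mono-< lt)))
  where
  nonNeg : ∀ {y} → 0 < y → ℚ.NonNegative (ι y)
  nonNeg {y} 0<y = ℚ.pos⇒nonNeg (ι y) {{ι-positive 0<y}}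

frac-ι : ∀ n → Frac (ι n) n 1
frac-ι n = frac z<s (trans (ι-* n 1) (cong ι (*-identityʳ n)))

frac-* : ∀ {p q x y x′ y′} → Frac p x y → Frac q x′ y′ → Frac (p ℚ.* q) (x * x′) (y * y′)
frac-* {p} {q} {x} {y} {x′} {y′} (frac 0<y px) (frac 0<y′ qx) = frac (*-mono-≤ 0<y 0<y′)
  (trans (cong (p ℚ.* q ℚ.*_) (sym (ι-* y y′)))
    (trans (ℚ-interchange p q (ι y) (ι y′)) (trans (cong₂ ℚ._*_ px qx) (ι-* x x′))))

frac-^ : ∀ {q x y} → Frac q x y → ∀ k → Frac (q ^ℚ k) (x ^ k) (y ^ k)
frac-^ f zero    = frac-ι 1
frac-^ f (suc k) = frac-* f (frac-^ f k)

frac-nonNeg : ∀ {p} → 0ℚ ℚ.≤ p → ∃[ x ] Frac p x (↧ₙ p)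
frac-nonNeg {p@(mkℚ (ℤ.+ x) d c)}  0≤p = x , frac z<s (numerator p)
frac-nonNeg {p@(mkℚ -[1+ x ] d c)} (*≤* ())

frac-pos : ∀ {p} → 0ℚ ℚ.< p → ∃[ x ] Frac p x (↧ₙ p)
frac-pos 0<p = frac-nonNeg (ℚ.<⇒≤ 0<p)

archimedean : ∀ p → ∃[ n ] p ℚ.< ι n
archimedean p with 0ℚ ℚ.<? p
... | no 0≮p  = 1 , ℚ.≤-<-trans (ℚ.≮⇒≥ 0≮p) (ι-mono-< {0} {1} z<s)
... | yes 0<p with frac-pos 0<p
... | x , f = suc x , frac-<⁻¹ f (frac-ι (suc x))
  (≤-trans (≤-reflexive (cong suc (*-identityʳ x))) (m≤m*n (suc x) (↧ₙ p)))

frac-pow : ∀ b k → Frac (pow b k) (b ^ k) 1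
frac-pow b k = subst (Frac (pow b k) (b ^ k)) (^-zeroˡ k) (frac-^ (frac-ι b) k)

module _ {b q x y} .{{_ : NonZero b}} (f : Frac q x y) (p : ℚ) where

  below : q <[ b ^ p ] → x ^ ↧ₙ p * b ^ negPart (↥ p) < b ^ posPart (↥ p) * y ^ ↧ₙ p
  below (inj₂ lt) = subst₂ _<_ (*-identityʳ _) (cong (b ^ posPart (↥ p) *_) (*-identityʳ _))
    (frac-< (frac-* (frac-^ f (↧ₙ p)) (frac-pow b (negPart (↥ p)))) (frac-pow b (posPart (↥ p))) lt)
  -- A natural numerator with q ≤ 0 is 0, and the left side vanishes since the denominator of p is
  -- positive.
  below (inj₁ q≤0) = subst (λ z → z * b ^ negPart (↥ p) < b ^ posPart (↥ p) * y ^ ↧ₙ p) (sym 0^d)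
    (*-mono-≤ (m^n>0 b (posPart (↥ p))) (m^n>0 y {{>-nonZero (0<den f)}} (↧ₙ p)))
    where
    x≡0 : x ≡ 0
    x≡0 = n≤0⇒n≡0 (≮⇒≥ λ 0<x → ℚ.<-irrefl refl (ℚ.<-≤-trans
      (frac-<⁻¹ (frac-ι 0) f (≤-trans 0<x (≤-reflexive (sym (*-identityʳ x))))) q≤0))
    0^d : x ^ ↧ₙ p ≡ 0
    0^d = cong (_^ ↧ₙ p) x≡0

  above : [ b ^ p ]< q → b ^ posPart (↥ p) * y ^ ↧ₙ p < x ^ ↧ₙ p * b ^ negPart (↥ p)
  above (_ , lt) = subst₂ _<_ (cong (b ^ posPart (↥ p) *_) (*-identityʳ _)) (*-identityʳ _)
    (frac-< (frac-pow b (posPart (↥ p))) (frac-* (frac-^ f (↧ₙ p)) (frac-pow b (negPart (↥ p)))) lt)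

exponent : ∀ {p} → 0ℚ ℚ.< p → ∃[ a ] Frac p a (↧ₙ p) × posPart (↥ p) ≡ a × negPart (↥ p) ≡ 0
exponent {p@(mkℚ (ℤ.+ zero)    d c)} (*<* (ℤ.+<+ ()))
exponent {p@(mkℚ (ℤ.+ (suc a)) d c)} 0<p = suc a , frac z<s (numerator p) , refl , refl
exponent {p@(mkℚ -[1+ a ] d c)}    (*<* ())

posPart≡0 : ∀ {p} → p ℚ.≤ 0ℚ → posPart (↥ p) ≡ 0
posPart≡0 {mkℚ (ℤ.+ zero)    d c} _ = refl
posPart≡0 {mkℚ (ℤ.+ (suc a)) d c} (*≤* (ℤ.+≤+ ()))
posPart≡0 {mkℚ -[1+ a ] d c}    _ = refl

-- A power of b ≥ 1 with exponent at most 0 is at most 1; this disposes of the degenerate exponents.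
below⁰ : ∀ {b q x y} .{{_ : NonZero b}} p → p ℚ.≤ 0ℚ → Frac q x y → q <[ b ^ p ] → x < y
below⁰ {b} {q} {x} {y} p p≤0 f lt = ^-cancelʳ-< (↧ₙ p) (begin-strict
  x ^ ↧ₙ p                              ≤⟨ m≤m*n (x ^ ↧ₙ p) (b ^ negPart (↥ p)) {{m^n≢0 b (negPart (↥ p))}} ⟩
  x ^ ↧ₙ p * b ^ negPart (↥ p)          <⟨ below f p lt ⟩
  b ^ posPart (↥ p) * y ^ ↧ₙ p          ≡⟨ cong (λ k → b ^ k * y ^ ↧ₙ p) (posPart≡0 p≤0) ⟩
  1 * y ^ ↧ₙ p                          ≡⟨ *-identityˡ _ ⟩
  y ^ ↧ₙ p                              ∎)
  where open ≤-Reasoning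

below⁺ : ∀ p → 0ℚ ℚ.< p → ∃[ a ] Frac p a (↧ₙ p) ×
  (∀ {b q x y} .{{_ : NonZero b}} → Frac q x y → q <[ b ^ p ] → x ^ ↧ₙ p < b ^ a * y ^ ↧ₙ p)
below⁺ p 0<p with exponent 0<p
... | a , fp , pos≡a , neg≡0 = a , fp , λ {b} {q} {x} {y} f lt → subst₂ _<_
  (trans (cong (λ k → x ^ ↧ₙ p * b ^ k) neg≡0) (*-identityʳ _))
  (cong (λ k → b ^ k * y ^ ↧ₙ p) pos≡a) (below f p lt)

above⁺ : ∀ p → 0ℚ ℚ.< p → ∃[ a ] Frac p a (↧ₙ p) ×
  (∀ {b q x y} .{{_ : NonZero b}} → Frac q x y → [ b ^ p ]< q → b ^ a * y ^ ↧ₙ p < x ^ ↧ₙ p)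
above⁺ p 0<p with exponent 0<p
... | a , fp , pos≡a , neg≡0 = a , fp , λ {b} {q} {x} {y} f lt → subst₂ _<_
  (cong (λ k → b ^ k * y ^ ↧ₙ p) pos≡a)
  (trans (cong (λ k → x ^ ↧ₙ p * b ^ k) neg≡0) (*-identityʳ _)) (above f p lt)

-- Dedekind cuts

L-down : ∀ {x p q} → IsReal x → p ℚ.< q → L x q → L x p
L-down {p = p} {q} real p<q Lq = Equivalence.from (IsReal.L-rounded real p) (q , p<q , Lq)

L<U : ∀ {x p q} → IsReal x → L x p → U x q → p ℚ.< q
L<U {x} {p} {q} real Lp Uq with Equivalence.to (IsReal.L-rounded real p) Lp
... | p′ , p<p′ , Lp′ = ℚ.≰⇒> λ q≤p → IsReal.disjoint real q (L-down real (ℚ.≤-<-trans q≤p p<p′) Lp′ , Uq)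

isReal-fromℚ : ∀ p → IsReal (fromℚ p)
isReal-fromℚ p = record
  { L-inhabited = p ℚ.- 1ℚ , subst (p ℚ.- 1ℚ ℚ.<_) (ℚ.+-identityʳ p) (ℚ.+-monoʳ-< p (toWitness {a? = ℚ.- 1ℚ ℚ.<? 0ℚ} _))
  ; U-inhabited = p ℚ.+ 1ℚ , subst (ℚ._< p ℚ.+ 1ℚ) (ℚ.+-identityʳ p) (ℚ.+-monoʳ-< p (toWitness {a? = 0ℚ ℚ.<? 1ℚ} _))
  ; L-rounded   = λ q → mk⇔ (λ q<p → let m , q<m , m<p = ℚ.<-dense q<p in m , q<m , m<p)
                            (λ (m , q<m , m<p) → ℚ.<-trans q<m m<p)
  ; U-rounded   = λ q → mk⇔ (λ p<q → let m , p<m , m<q = ℚ.<-dense p<q in m , m<q , p<m)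
                            (λ (m , m<q , p<m) → ℚ.<-trans p<m m<q)
  ; disjoint    = λ q (q<p , p<q) → ℚ.<-asym q<p p<q
  ; located     = locate
  }
  where
  locate : ∀ q q′ → q ℚ.< q′ → q ℚ.< p ⊎ p ℚ.< q′
  locate q q′ q<q′ with q ℚ.<? p
  ... | yes q<p = inj₁ q<p
  ... | no  q≮p = inj₂ (ℚ.≤-<-trans (ℚ.≮⇒≥ q≮p) q<q′)

*-mono-<-pos : ∀ {a b c d} → 0ℚ ℚ.< b → 0ℚ ℚ.< c → a ℚ.< b → c ℚ.< d → a ℚ.* c ℚ.< b ℚ.* d
*-mono-<-pos {a} {b} {c} {d} 0<b 0<c a<b c<d = ℚ.<-trans
  (ℚ.*-monoˡ-<-pos c {{ℚ.positive 0<c}} a<b) (ℚ.*-monoʳ-<-pos b {{ℚ.positive 0<b}} c<d)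

-- The endpoints of an interval product may be negative a priori. As b > 0, q < b c forces c > 0,
-- and then q < a c forces a > 0.
L-*-pos : ∀ {x y q} → L (x *ʳ y) q → 0ℚ ℚ.≤ q → (∀ {b} → U x b → 0ℚ ℚ.< b) →
  ∃[ a ] ∃[ c ] (0ℚ ℚ.< a × 0ℚ ℚ.< c × L x a × L y c × q ℚ.< a ℚ.* c)
L-*-pos {q = q} (a , b , c , d , La , Ub , Lc , Ud , q<ac , _ , q<bc , _) 0≤q x>0 =
  a , c , 0<a , 0<c , La , Lc , q<ac
  where
  0<c : 0ℚ ℚ.< c
  0<c = ℚ.*-cancelˡ-<-nonNeg b {{ℚ.nonNegative (ℚ.<⇒≤ (x>0 Ub))}}
    (subst (ℚ._< b ℚ.* c) (sym (ℚ.*-zeroʳ b)) (ℚ.≤-<-trans 0≤q q<bc))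
  0<a : 0ℚ ℚ.< a
  0<a = ℚ.*-cancelʳ-<-nonNeg c {{ℚ.nonNegative (ℚ.<⇒≤ 0<c)}}
    (subst (ℚ._< a ℚ.* c) (sym (ℚ.*-zeroˡ c)) (ℚ.≤-<-trans 0≤q q<ac))

L-inv : ∀ {y c z} → 0ℚ ℚ.< c → L (inv y) c → (∀ {u} → U y u → z ℚ.< u) → c ℚ.* z ℚ.< 1ℚ
L-inv {c = c} 0<c (u , Uu , cu<1) z<U = ℚ.<-trans (ℚ.*-monoʳ-<-pos c {{ℚ.positive 0<c}} (z<U Uu)) cu<1

L-/-pos : ∀ {x y q z} → 0ℚ ℚ.< z → 0ℚ ℚ.≤ q → (∀ {b} → U x b → 0ℚ ℚ.< b) → (∀ {u} → U y u → z ℚ.< u) →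
  L (x /ʳ y) q → ∃[ a ] (0ℚ ℚ.< a × L x a × q ℚ.* z ℚ.< a)
L-/-pos {x} {y} {q} {z} 0<z 0≤q x>0 z<U Lq with L-*-pos Lq 0≤q x>0
... | a , c , 0<a , 0<c , La , Lc , q<ac = a , 0<a , La , (begin-strict
  q ℚ.* z            <⟨ ℚ.*-monoˡ-<-pos z {{ℚ.positive 0<z}} q<ac ⟩
  a ℚ.* c ℚ.* z      ≡⟨ ℚ.*-assoc a c z ⟩
  a ℚ.* (c ℚ.* z)    <⟨ ℚ.*-monoʳ-<-pos a {{ℚ.positive 0<a}} (L-inv {y} 0<c Lc z<U) ⟩
  a ℚ.* 1ℚ           ≡⟨ ℚ.*-identityʳ a ⟩
  a                  ∎)
  where open ℚ.≤-Reasoning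

0≤ι : ∀ n → 0ℚ ℚ.≤ ι n
0≤ι n = ℚ.≮⇒≥ λ ιn<0 → n≮0 (ι-cancel-< {n} {0} ιn<0)

U-fromℕ-pos : ∀ n {b} → U (fromℕ n) b → 0ℚ ℚ.< b
U-fromℕ-pos n = ℚ.≤-<-trans (0≤ι n)

U-log-pos : ∀ {x b} → (∀ {q} → U x q → 1ℚ ℚ.< q) → U (log x) b → 0ℚ ℚ.< b
U-log-pos {b = b} x≥1 (q , q<2^b , Uq) = ℚ.≰⇒> λ b≤0 →
  <-asym (below⁰ {2} {q} b b≤0 (proj₂ q-frac) q<2^b)
         (subst₂ _<_ (*-identityˡ _) (*-identityʳ _) (frac-< (frac-ι 1) (proj₂ q-frac) (x≥1 Uq)))
  where
  q-frac = frac-pos (ℚ.<-trans (toWitness {a? = 0ℚ ℚ.<? 1ℚ} _) (x≥1 Uq))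

L-log : ∀ {x a} K → 0ℚ ℚ.< a → (∀ {q} → L x q → q ℚ.< ι K) → L (log x) a →
  ∃[ n ] (Frac a n (↧ₙ a) × 2 ^ n < K ^ ↧ₙ a)
L-log {a = a} K 0<a x≤K (q , 2^a<q , Lq) =
  let n , fa , up = above⁺ a 0<a
      x , fq      = frac-pos (proj₁ 2^a<q)
  in n , fa , *-cancelʳ-< (↧ₙ q ^ ↧ₙ a) (2 ^ n) (K ^ ↧ₙ a) (begin-strict
    2 ^ n * ↧ₙ q ^ ↧ₙ a     <⟨ up {2} {q} fq 2^a<q ⟩
    x ^ ↧ₙ a                ≤⟨ ^-monoˡ-≤ (↧ₙ a) (<⇒≤ (subst (_< K * ↧ₙ q) (*-identityʳ x) (frac-< fq (frac-ι K) (x≤K Lq)))) ⟩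
    (K * ↧ₙ q) ^ ↧ₙ a       ≡⟨ [m*n]^o K (↧ₙ q) (↧ₙ a) ⟩
    K ^ ↧ₙ a * ↧ₙ q ^ ↧ₙ a  ∎)
  where open ≤-Reasoning

-- Passing to m - 1 loses nothing: choosing the m-th object greedily only has to
-- avoid the m - 1 previous ones.
floor-pred : ∀ {m x} → IsFloor m x → ∃[ m′ ] (m ≤ suc m′ × (m′ ≡ 0 ⊎ L x (ι m′)))
floor-pred {zero}  _       = 0 , z≤n , inj₁ refl
floor-pred {suc m} (m≤x , _) = m , ≤-refl , inj₂ (m≤x (ι m) (ι-mono-< (n<1+n m)))

^-pos : ∀ {z} → 0ℚ ℚ.< z → ∀ k → 0ℚ ℚ.< z ^ℚ k
^-pos 0<z zero    = toWitness {a? = 0ℚ ℚ.<? 1ℚ} _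
^-pos {z} 0<z (suc k) = subst (ℚ._< z ℚ.* z ^ℚ k) (ℚ.*-zeroʳ z) (ℚ.*-monoʳ-<-pos z {{ℚ.positive 0<z}} (^-pos 0<z k))

U-^ⁿ : ∀ {x z} → 0ℚ ℚ.< z → (∀ {b} → U x b → z ℚ.< b) → ∀ k {u} → U (x ^ⁿ k) u → z ^ℚ k ℚ.< u
U-^ⁿ 0<z z<U zero    1<u = 1<u
U-^ⁿ 0<z z<U (suc k) (_ , b , _ , d , _ , Ub , _ , Ud , _ , _ , _ , bd<u) = ℚ.<-trans
  (*-mono-<-pos (ℚ.<-trans 0<z (z<U Ub)) (^-pos 0<z k) (z<U Ub) (U-^ⁿ 0<z z<U k Ud)) bd<u

5/2 : ℚ
5/2 = ℤ.+ 5 ℚ./ 2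

frac-5/2 : Frac 5/2 5 2
frac-5/2 = frac z<s refl

-- The partial sum 1 + 1 + 1/2. All estimates involving e rest on it.
5/2<U-e : ∀ {b} → U e b → 5/2 ℚ.< b
5/2<U-e (b′ , b′<b , sums≤b′) = ℚ.≤-<-trans (sums≤b′ 2) b′<b

[5/2]^k<U-e^k : ∀ k {u} → U (e ^ⁿ k) u → 5/2 ^ℚ k ℚ.< u
[5/2]^k<U-e^k = U-^ⁿ (toWitness {a? = 0ℚ ℚ.<? 5/2} _) 5/2<U-e

-- Powers with rational exponents

^-flip : ∀ b x y → (b ^ x) ^ y ≡ (b ^ y) ^ x
^-flip b x y = trans (^-*-assoc b x y) (trans (cong (b ^_) (*-comm x y)) (sym (^-*-assoc b y x)))

^-exponent : ∀ b x y z w → x * y ≡ z * w → (b ^ x) ^ y ≡ (b ^ z) ^ w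
^-exponent b x y z w eq = trans (^-*-assoc b x y) (trans (cong (b ^_) eq) (sym (^-*-assoc b z w)))

module _ {r l : ℕ} .{{_ : NonZero r}} (r≤2^l : r ≤ 2 ^ l) where
  open ≤-Reasoning

  -- With p = a / d and 2 p ≤ n / f ≤ log K: m² ≤ r ^ (2 p) ≤ (2 ^ l) ^ (log K) = K ^ l.
  square-power : ∀ m K d a n f .{{_ : NonZero d}} .{{_ : NonZero f}} →
    m ^ d ≤ r ^ a → a * 2 * f ≤ n * d → 2 ^ n ≤ K ^ f → m * m ≤ K ^ l
  square-power m K d a n f mᵈ≤ a≤ 2ⁿ≤ = ^-cancelʳ-≤ (d * f) {{m*n≢0 d f}} (begin
    (m * m) ^ (d * f)        ≡⟨ cong (_^ (d * f)) (cong (m *_) (sym (*-identityʳ m))) ⟩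
    (m ^ 2) ^ (d * f)        ≡⟨ ^-exponent m 2 (d * f) d (2 * f) (e₁ d f) ⟩
    (m ^ d) ^ (2 * f)        ≤⟨ ^-monoˡ-≤ (2 * f) mᵈ≤ ⟩
    (r ^ a) ^ (2 * f)        ≡⟨ trans (^-*-assoc r a (2 * f)) (cong (r ^_) (sym (*-assoc a 2 f))) ⟩
    r ^ (a * 2 * f)          ≤⟨ ^-monoʳ-≤ r a≤ ⟩
    r ^ (n * d)              ≤⟨ ^-monoˡ-≤ (n * d) r≤2^l ⟩
    (2 ^ l) ^ (n * d)        ≡⟨ ^-exponent 2 l (n * d) n (l * d) (e₂ l n d) ⟩
    (2 ^ n) ^ (l * d)        ≤⟨ ^-monoˡ-≤ (l * d) 2ⁿ≤ ⟩
    (K ^ f) ^ (l * d)        ≡⟨ ^-exponent K f (l * d) l (d * f) (e₃ f l d) ⟩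
    (K ^ l) ^ (d * f)        ∎)
    where
    e₁ : ∀ d f → 2 * (d * f) ≡ d * (2 * f)
    e₁ = solve-∀
    e₂ : ∀ l n d → l * (n * d) ≡ n * (l * d)
    e₂ = solve-∀
    e₃ : ∀ f l d → f * (l * d) ≡ l * (d * f)
    e₃ = solve-∀

  -- With p = a / d ≤ r / s: n < r ^ p ≤ 2 ^ (l r / s) ≤ 2 ^ t.
  power<2^ : ∀ n d a s t .{{_ : NonZero s}} → n ^ d < r ^ a → a * s ≤ r * d → r * l ≤ s * t → n < 2 ^ t
  power<2^ n d a s t nᵈ< a≤ rl≤ = ^-cancelʳ-< (d * s) (begin-strict
    n ^ (d * s)              ≡⟨ sym (^-*-assoc n d s) ⟩
    (n ^ d) ^ s              <⟨ ^-monoˡ-< s nᵈ< ⟩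
    (r ^ a) ^ s              ≡⟨ ^-*-assoc r a s ⟩
    r ^ (a * s)              ≤⟨ ^-monoˡ-≤ (a * s) r≤2^l ⟩
    (2 ^ l) ^ (a * s)        ≡⟨ ^-*-assoc 2 l (a * s) ⟩
    2 ^ (l * (a * s))        ≤⟨ ^-monoʳ-≤ 2 (begin
      l * (a * s)              ≤⟨ *-monoʳ-≤ l a≤ ⟩
      l * (r * d)              ≡⟨ e₁ l r d ⟩
      r * l * d                ≤⟨ *-monoˡ-≤ d rl≤ ⟩
      s * t * d                ≡⟨ e₂ s t d ⟩
      t * (d * s)              ∎) ⟩
    2 ^ (t * (d * s))        ≡⟨ sym (^-*-assoc 2 t (d * s)) ⟩
    (2 ^ t) ^ (d * s)        ∎)
    where
    e₁ : ∀ l r d → l * (r * d) ≡ r * l * d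
    e₁ = solve-∀
    e₂ : ∀ s t d → s * t * d ≡ t * (d * s)
    e₂ = solve-∀

  -- Of the two factors log r in the exponent of 2, one turns the base into r and the other is
  -- bounded by l.
  log²-power : ∀ m p d a da n₂ d₂ n₃ d₃ .{{_ : NonZero d}} .{{_ : NonZero d₂}} .{{_ : NonZero d₃}} →
    m ^ d ≤ 2 ^ p → p * (da * (d₂ * d₃)) ≤ a * (n₂ * n₃) * d →
    2 ^ n₂ ≤ r ^ d₂ → 2 ^ n₃ < r ^ d₃ → m ^ da ≤ r ^ (a * l)
  log²-power m p d a da n₂ d₂ n₃ d₃ mᵈ≤ p≤ 2ⁿ² 2ⁿ³ =
    ^-cancelʳ-≤ (d * (d₂ * d₃)) {{dd≢0}} (begin
    (m ^ da) ^ (d * (d₂ * d₃))       ≡⟨ ^-exponent m da (d * (d₂ * d₃)) d (da * (d₂ * d₃)) (e₁ da d (d₂ * d₃)) ⟩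
    (m ^ d) ^ (da * (d₂ * d₃))       ≤⟨ ^-monoˡ-≤ (da * (d₂ * d₃)) mᵈ≤ ⟩
    (2 ^ p) ^ (da * (d₂ * d₃))       ≡⟨ ^-*-assoc 2 p _ ⟩
    2 ^ (p * (da * (d₂ * d₃)))       ≤⟨ ^-monoʳ-≤ 2 p≤ ⟩
    2 ^ (a * (n₂ * n₃) * d)          ≡⟨ trans (cong (2 ^_) (e₂ a n₂ n₃ d)) (sym (^-*-assoc 2 n₂ (a * n₃ * d))) ⟩
    (2 ^ n₂) ^ (a * n₃ * d)          ≤⟨ ^-monoˡ-≤ (a * n₃ * d) 2ⁿ² ⟩
    (r ^ d₂) ^ (a * n₃ * d)          ≤⟨ ^-monoʳ-≤ (r ^ d₂) {{m^n≢0 r d₂}} (*-monoˡ-≤ d (*-monoʳ-≤ a n₃≤)) ⟩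
    (r ^ d₂) ^ (a * (l * d₃) * d)    ≡⟨ ^-exponent r d₂ (a * (l * d₃) * d) (a * l) (d * (d₂ * d₃)) (e₃ d₂ a l d₃ d) ⟩
    (r ^ (a * l)) ^ (d * (d₂ * d₃))  ∎)
    where
    instance
      d₂d₃≢0 : NonZero (d₂ * d₃)
      d₂d₃≢0 = m*n≢0 d₂ d₃
    dd≢0 : NonZero (d * (d₂ * d₃))
    dd≢0 = m*n≢0 d (d₂ * d₃)
    n₃≤ : n₃ ≤ l * d₃
    n₃≤ = ≮⇒≥ λ ld₃<n₃ → <⇒≱ 2ⁿ³ (begin
      r ^ d₃            ≤⟨ ^-monoˡ-≤ d₃ r≤2^l ⟩
      (2 ^ l) ^ d₃      ≡⟨ ^-*-assoc 2 l d₃ ⟩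
      2 ^ (l * d₃)      ≤⟨ ^-monoʳ-≤ 2 (<⇒≤ ld₃<n₃) ⟩
      2 ^ n₃            ∎)
    e₁ : ∀ a b c → a * (b * c) ≡ b * (a * c)
    e₁ = solve-∀
    e₂ : ∀ a b c d → a * (b * c) * d ≡ b * (a * c * d)
    e₂ = solve-∀
    e₃ : ∀ b a l c d → b * (a * (l * c) * d) ≡ a * l * (d * (b * c))
    e₃ = solve-∀

-- With s = (a - b) / d: x / y ≤ r ^ s and s + u / v ≤ 1 give x / y ≤ r ^ (1 - u / v). The numerator
-- of s is split because s may be negative.
complement-power : ∀ r x y d a b u v .{{_ : NonZero r}} .{{_ : NonZero d}} →
  x ^ d * r ^ b ≤ r ^ a * y ^ d → a * v + u * d ≤ d * v + b * v → x ^ v * r ^ u ≤ r ^ v * y ^ v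
complement-power r x y d a b u v xᵈ≤ a≤ = ^-cancelʳ-≤ d (*-cancelʳ-≤ _ _ (r ^ (b * v)) {{m^n≢0 r (b * v)}} (begin
  (x ^ v * r ^ u) ^ d * r ^ (b * v)          ≡⟨ cong₂ _*_ (trans ([m*n]^o (x ^ v) (r ^ u) d) (cong₂ _*_ (^-flip x v d) (^-*-assoc r u d))) (sym (^-*-assoc r b v)) ⟩
  (x ^ d) ^ v * r ^ (u * d) * (r ^ b) ^ v    ≡⟨ trans (xy*z≡xz*y ((x ^ d) ^ v) _ _) (cong (_* r ^ (u * d)) (sym ([m*n]^o (x ^ d) (r ^ b) v))) ⟩
  (x ^ d * r ^ b) ^ v * r ^ (u * d)          ≤⟨ *-monoˡ-≤ (r ^ (u * d)) (^-monoˡ-≤ v xᵈ≤) ⟩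
  (r ^ a * y ^ d) ^ v * r ^ (u * d)          ≡⟨ cong (_* r ^ (u * d)) (trans ([m*n]^o (r ^ a) (y ^ d) v) (cong₂ _*_ (^-*-assoc r a v) (^-flip y d v))) ⟩
  r ^ (a * v) * (y ^ v) ^ d * r ^ (u * d)    ≡⟨ trans (xy*z≡xz*y (r ^ (a * v)) _ _) (cong (_* (y ^ v) ^ d) (sym (^-distribˡ-+-* r (a * v) (u * d)))) ⟩
  r ^ (a * v + u * d) * (y ^ v) ^ d          ≤⟨ *-monoˡ-≤ ((y ^ v) ^ d) (^-monoʳ-≤ r a≤) ⟩
  r ^ (d * v + b * v) * (y ^ v) ^ d          ≡⟨ cong (_* (y ^ v) ^ d) (^-distribˡ-+-* r (d * v) (b * v)) ⟩
  r ^ (d * v) * r ^ (b * v) * (y ^ v) ^ d    ≡⟨ trans (xy*z≡xz*y (r ^ (d * v)) _ _) (cong (λ z → z * (y ^ v) ^ d * r ^ (b * v)) (trans (cong (r ^_) (*-comm d v)) (sym (^-*-assoc r v d)))) ⟩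
  (r ^ v) ^ d * (y ^ v) ^ d * r ^ (b * v)    ≡⟨ cong (_* r ^ (b * v)) (sym ([m*n]^o (r ^ v) (y ^ v) d)) ⟩
  (r ^ v * y ^ v) ^ d * r ^ (b * v)          ∎))
  where
  open ≤-Reasoning

square-≤ : ∀ x y r E d a .{{_ : NonZero r}} .{{_ : NonZero d}} →
  x ^ d ≤ r ^ a * y ^ d → a * 2 ≤ E * d → x * x ≤ r ^ E * (y * y)
square-≤ x y r E d a xᵈ≤ a≤ = ^-cancelʳ-≤ d (begin
  (x * x) ^ d                           ≡⟨ [m*n]^o x x d ⟩
  x ^ d * x ^ d                         ≤⟨ *-mono-≤ xᵈ≤ xᵈ≤ ⟩
  r ^ a * y ^ d * (r ^ a * y ^ d)       ≡⟨ e₁ (r ^ a) (y ^ d) ⟩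
  r ^ a * r ^ a * (y ^ d * y ^ d)       ≡⟨ cong₂ _*_ (trans (sym (^-distribˡ-+-* r a a)) (cong (r ^_) (e₂ a))) (sym ([m*n]^o y y d)) ⟩
  r ^ (a * 2) * (y * y) ^ d             ≤⟨ *-monoˡ-≤ ((y * y) ^ d) (^-monoʳ-≤ r a≤) ⟩
  r ^ (E * d) * (y * y) ^ d             ≡⟨ cong (_* (y * y) ^ d) (sym (^-*-assoc r E d)) ⟩
  (r ^ E) ^ d * (y * y) ^ d             ≡⟨ sym ([m*n]^o (r ^ E) (y * y) d) ⟩
  (r ^ E * (y * y)) ^ d                 ∎)
  where
  open ≤-Reasoning
  e₁ : ∀ a b → a * b * (a * b) ≡ a * a * (b * b)
  e₁ = solve-∀
  e₂ : ∀ a → a + a ≡ a * 2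
  e₂ = solve-∀

-- n ≤ α γ with α² ≤ r ^ E and γ ≤ (2/5) ^ E, the latter standing for e ^ (- E).
random-small : ∀ n xa ya xc yc r E .{{_ : NonZero ya}} .{{_ : NonZero yc}} → n * (ya * yc) ≤ xa * xc →
  xa * xa ≤ r ^ E * (ya * ya) → xc * 5 ^ E ≤ yc * 2 ^ E → n * n * 25 ^ E ≤ 4 ^ E * r ^ E
random-small n xa ya xc yc r E n≤ a≤ c≤ = *-cancelʳ-≤ _ _ (ya * yc * (ya * yc)) {{m*n≢0 _ _ {{m*n≢0 ya yc}} {{m*n≢0 ya yc}}}} (begin
  n * n * 25 ^ E * (ya * yc * (ya * yc))              ≡⟨ e₁ n (25 ^ E) (ya * yc) ⟩
  n * (ya * yc) * (n * (ya * yc)) * 25 ^ E            ≤⟨ *-mono-≤ (*-mono-≤ n≤ n≤) (≤-reflexive ([m*n]^o 5 5 E)) ⟩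
  xa * xc * (xa * xc) * (5 ^ E * 5 ^ E)               ≡⟨ e₂ xa xc (5 ^ E) ⟩
  xa * xa * (xc * 5 ^ E * (xc * 5 ^ E))               ≤⟨ *-mono-≤ a≤ (*-mono-≤ c≤ c≤) ⟩
  r ^ E * (ya * ya) * (yc * 2 ^ E * (yc * 2 ^ E))     ≡⟨ e₃ (r ^ E) ya yc (2 ^ E) ⟩
  2 ^ E * 2 ^ E * r ^ E * (ya * yc * (ya * yc))       ≡⟨ cong (λ z → z * r ^ E * (ya * yc * (ya * yc))) (sym ([m*n]^o 2 2 E)) ⟩
  4 ^ E * r ^ E * (ya * yc * (ya * yc))               ∎)
  where
  open ≤-Reasoning
  e₁ : ∀ n z y → n * n * z * (y * y) ≡ n * y * (n * y) * z
  e₁ = solve-∀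
  e₂ : ∀ a c z → a * c * (a * c) * (z * z) ≡ a * a * (c * z * (c * z))
  e₂ = solve-∀
  e₃ : ∀ r a c z → r * (a * a) * (c * z * (c * z)) ≡ z * z * r * (a * c * (a * c))
  e₃ = solve-∀

-- The three parts

below⁰-ℕ : ∀ {b n} .{{_ : NonZero b}} p → ¬ (0ℚ ℚ.< p) → ι n <[ b ^ p ] → n ≡ 0
below⁰-ℕ {b} {n} p p≯0 lt = n<1⇒n≡0 (below⁰ {b} {ι n} p (ℚ.≮⇒≥ p≯0) (frac-ι n) lt)

below⁺-ℕ : ∀ {b n} .{{_ : NonZero b}} p → 0ℚ ℚ.< p → ι n <[ b ^ p ] → ∃[ a ] (Frac p a (↧ₙ p) × n ^ ↧ₙ p < b ^ a)
below⁺-ℕ {b} {n} p 0<p lt =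
  let a , fp , low = below⁺ p 0<p
  in a , fp , subst (n ^ ↧ₙ p <_) (trans (cong (b ^ a *_) (^-zeroˡ (↧ₙ p))) (*-identityʳ _)) (low {b} {ι n} (frac-ι n) lt)

0<ι : ∀ n .{{_ : NonZero n}} → 0ℚ ℚ.< ι n
0<ι (suc n) = ι-mono-< {0} {suc n} z<s

≡0⊎ : ∀ {n} {A : Set} (P : ℕ → Set) → P 0 → (A → P n) → n ≡ 0 ⊎ A → P n
≡0⊎ P P₀ A⇒P (inj₁ refl) = P₀
≡0⊎ P P₀ A⇒P (inj₂ a)    = A⇒P a

module PartI (C : Cut) (C-real : IsReal C) (e²<C : (e ^ⁿ 2) <ʳ C) where

  -- e² > (5/2)² = 25/4 > 6.
  6<C : L C (ι 6)
  6<C = let q , Ue² , LCq = e²<C in L-down C-real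
    (ℚ.<-trans (frac-<⁻¹ (frac-ι 6) (frac-^ frac-5/2 2) (<ᵇ⇒< 24 25 _)) ([5/2]^k<U-e^k 2 Ue²)) LCq

  -- The gap between k and k + 2 is harmless, because 4 (k + 2) < k² for k ≥ 6.
  locate-integer : ∃[ k ] (6 ≤ k × L C (ι k) × U C (ι (2 + k)))
  locate-integer =
    let u , Uu  = IsReal.U-inhabited C-real
        N , u<N = archimedean u
    in walk Uu u<N N 6 ≤-refl 6<C (m≤m+n N 6)
    where
    -- Comparison with a real is undecidable; locatedness at two consecutive integers leaves the gap
    -- of 2.
    Step : ℕ → Set
    Step k = L C (ι (1 + k)) ⊎ U C (ι (2 + k))
    module _ {u N} (Uu : U C u) (u<N : u ℚ.< ι N) where
      walk : ∀ s k → 6 ≤ k → L C (ι k) → N ≤ s + k → ∃[ k ] (6 ≤ k × L C (ι k) × U C (ι (2 + k)))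
      next : ∀ s k → 6 ≤ k → L C (ι k) → N ≤ suc s + k → Step k → ∃[ k ] (6 ≤ k × L C (ι k) × U C (ι (2 + k)))
      walk zero    k 6≤k k<C N≤k = contradiction N≤k (<⇒≱ (ι-cancel-< {k} {N} (ℚ.<-trans (L<U C-real k<C Uu) u<N)))
      walk (suc s) k 6≤k k<C N≤  = next s k 6≤k k<C N≤
        (IsReal.located C-real (ι (1 + k)) (ι (2 + k)) (ι-mono-< (n<1+n (1 + k))))
      next s k 6≤k k<C N≤ (inj₁ 1+k<C) = walk s (1 + k) (m≤n⇒m≤1+n 6≤k) 1+k<C (subst (N ≤_) (sym (+-suc s k)) N≤)
      next s k 6≤k k<C N≤ (inj₂ C<2+k) = k , 6≤k , k<C , C<2+k

  module _ {r l k : ℕ} .{{_ : NonZero r}} (r≤2^l : r ≤ 2 ^ l) (6≤k : 6 ≤ k) (k<C : L C (ι k)) (C<2+k : U C (ι (2 + k))) where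

    private
      instance
        k≢0 : NonZero k
        k≢0 = >-nonZero (≤-trans z<s 6≤k)
        2k≢0 : NonZero (2 * k)
        2k≢0 = m*n≢0 2 k

      logC>0 : ∀ {b} → U (log C) b → 0ℚ ℚ.< b
      logC>0 = U-log-pos {C} (λ Uq → ℚ.<-trans (ι-mono-< {1} {6} (s≤s (s≤s z≤n))) (L<U C-real 6<C Uq))

      2k<2C : ∀ {u} → U (fromℕ 2 *ʳ C) u → ι (2 * k) ℚ.< u
      2k<2C {u} (_ , b , _ , d , _ , 2<b , _ , Ud , _ , _ , _ , bd<u) = subst (ℚ._< u) (ι-* 2 k)
        (ℚ.<-trans (*-mono-<-pos (ℚ.<-trans (0<ι 2) 2<b) (0<ι k) 2<b (L<U C-real k<C Ud)) bd<u)

    m-bound : ∀ m → L (r ^ʳ (log C /ʳ fromℕ 2)) (ι m) → m * m ≤ (2 + k) ^ l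
    m-bound m (p , Lp , lt) = cases (0ℚ ℚ.<? p)
      where
      cases : Dec (0ℚ ℚ.< p) → m * m ≤ (2 + k) ^ l
      cases (no p≯0)  = subst (λ m → m * m ≤ (2 + k) ^ l) (sym (below⁰-ℕ {r} {m} p p≯0 lt)) z≤n
      cases (yes 0<p) =
        let np , fp , mᵈ<         = below⁺-ℕ {r} {m} p 0<p lt
            a , 0<a , La , p*2<a  = L-/-pos {log C} {fromℕ 2} {p} {ι 2} (0<ι 2) (ℚ.<⇒≤ 0<p) logC>0 (λ 2<u → 2<u) Lp
            na , fa , 2ⁿ<         = L-log {C} {a} (2 + k) 0<a (λ Lq → L<U C-real Lq C<2+k) La
        in square-power {r} {l} r≤2^l m (2 + k) (↧ₙ p) np na (↧ₙ a) (<⇒≤ mᵈ<)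
          (<⇒≤ (subst (np * 2 * ↧ₙ a <_) (cong (na *_) (*-identityʳ (↧ₙ p)))
            (frac-< (frac-* fp (frac-ι 2)) fa p*2<a)))
          (<⇒≤ 2ⁿ<)

    n-bound : ∀ n t → r * l ≤ 2 * k * t → L (r ^ʳ (fromℕ r /ʳ (fromℕ 2 *ʳ C))) (ι n) → n < 2 ^ t
    n-bound n t rl≤ (p , Lp , lt) = cases (0ℚ ℚ.<? p)
      where
      cases : Dec (0ℚ ℚ.< p) → n < 2 ^ t
      cases (no p≯0)  = subst (_< 2 ^ t) (sym (below⁰-ℕ {r} {n} p p≯0 lt)) (m^n>0 2 t)
      cases (yes 0<p) =
        let np , fp , nᵈ<          = below⁺-ℕ {r} {n} p 0<p lt
            a , 0<a , a<r , p*2k<a = L-/-pos {fromℕ r} {fromℕ 2 *ʳ C} {p} {ι (2 * k)} (0<ι (2 * k)) (ℚ.<⇒≤ 0<p) (U-fromℕ-pos r) 2k<2C Lp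
        in power<2^ {r} {l} r≤2^l n (↧ₙ p) np (2 * k) t nᵈ<
          (<⇒≤ (subst₂ _<_ (*-identityʳ _) (cong (r *_) (*-identityʳ (↧ₙ p)))
            (frac-< (frac-* fp (frac-ι (2 * k))) (frac-ι r) (ℚ.<-trans p*2k<a a<r))))
          rl≤

  theorem : ForLarge (λ r → g⌊ r ^ʳ (log C /ʳ fromℕ 2) , r ^ʳ (fromℕ r /ʳ (fromℕ 2 *ʳ C)) ⌋≤ r)
  theorem = let k , 6≤k , k<C , C<2+k = locate-integer in 64 * k , large 6≤k k<C C<2+k
    where
    module _ {k} (6≤k : 6 ≤ k) (k<C : L C (ι k)) (C<2+k : U C (ι (2 + k))) where
      instance
        k≢0 : NonZero k
        k≢0 = >-nonZero (≤-trans z<s 6≤k)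
        2k≢0 : NonZero (2 * k)
        2k≢0 = m*n≢0 2 k
      large : ∀ r → 64 * k ≤ r → g⌊ r ^ʳ (log C /ʳ fromℕ 2) , r ^ʳ (fromℕ r /ʳ (fromℕ 2 *ʳ C)) ⌋≤ r
      large zero    64k≤0 = contradiction (≤-trans (m≤n*m k 64) 64k≤0) (<⇒≱ (≤-trans z<s 6≤k))
      large r@(suc _) 64k≤r m n m-floor n-floor =
        let l , 2^l≤r , r<2^1+l = binary-length r
            m′ , m≤1+m′ , Lm    = floor-pred {m} {r ^ʳ (log C /ʳ fromℕ 2)} m-floor
            n′ , n≤1+n′ , Ln    = floor-pred {n} {r ^ʳ (fromℕ r /ʳ (fromℕ 2 *ʳ C))} n-floor
            P                   = r * suc l
            -- log n′ is at most r (l + 1) / (2 k), because log r ≤ l + 1 and k < C; t is the next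
            -- integer above this quotient.
            t                   = suc (P / (2 * k))
            r≤2^1+l             = <⇒≤ r<2^1+l
        in colorable⇒g≤ (code-colorable r t l m′ m n 2^l≤r m≤1+m′
          (≤-trans n≤1+n′ (≡0⊎ (_< 2 ^ t) (m^n>0 2 t) (n-bound {r} {suc l} r≤2^1+l 6≤k k<C C<2+k n′ t (P≤2kt P)) Ln))
          (inj₂ (code-bound₁ k P t (suc l) m′ 6≤k (≤-trans 64k≤r (m≤m*n r (suc l))) (2kt≤ P)
            (≡0⊎ (λ m → m * m ≤ (2 + k) ^ suc l) z≤n (m-bound {r} {suc l} r≤2^1+l 6≤k k<C C<2+k m′) Lm))))
        where
        2kt≤ : ∀ P → 2 * k * suc (P / (2 * k)) ≤ P + 2 * k
        2kt≤ P = begin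
          2 * k * suc (P / (2 * k))        ≡⟨ *-comm (2 * k) (suc (P / (2 * k))) ⟩
          2 * k + P / (2 * k) * (2 * k)    ≤⟨ +-monoʳ-≤ (2 * k) (m/n*n≤m P (2 * k)) ⟩
          2 * k + P                        ≡⟨ +-comm (2 * k) P ⟩
          P + 2 * k                        ∎
          where open ≤-Reasoning
        P≤2kt : ∀ P → P ≤ 2 * k * suc (P / (2 * k))
        P≤2kt P = begin
          P                                                ≡⟨ m≡m%n+[m/n]*n P (2 * k) ⟩
          P % (2 * k) + P / (2 * k) * (2 * k)              ≤⟨ +-monoˡ-≤ _ (<⇒≤ (m%n<n P (2 * k))) ⟩
          2 * k + P / (2 * k) * (2 * k)                    ≡⟨ *-comm (suc (P / (2 * k))) (2 * k) ⟩
          2 * k * suc (P / (2 * k))                        ∎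
          where open ≤-Reasoning

signed-numerator : ∀ s → s ℚ.* ι (↧ₙ s) ℚ.+ ι (negPart (↥ s)) ≡ ι (posPart (↥ s))
signed-numerator s@(mkℚ (ℤ.+ zero)    d c) = cong (ℚ._+ 0ℚ) (numerator s)
signed-numerator s@(mkℚ (ℤ.+ (suc n)) d c) = trans (cong (ℚ._+ 0ℚ) (numerator s)) (ℚ.+-identityʳ (ι (suc n)))
signed-numerator s@(mkℚ -[1+ n ]    d c) = trans (cong (ℚ._+ ι (suc n)) (numerator s)) (ℚ.+-inverseˡ (ι (suc n)))

s+a<1⇒ : ∀ {s a u v} → Frac a u v → s ℚ.+ a ℚ.< 1ℚ →
  posPart (↥ s) * v + u * ↧ₙ s < ↧ₙ s * v + negPart (↥ s) * v
s+a<1⇒ {s} {a} {u} {v} (frac 0<v av≡u) s+a<1 = ι-cancel-< (subst₂ ℚ._<_ left right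
  (ℚ.+-monoˡ-< (ι neg ℚ.* ι v) (ℚ.*-monoˡ-<-pos (ι d ℚ.* ι v) {{dv>0}} s+a<1)))
  where
  d neg pos : ℕ
  d = ↧ₙ s
  neg = negPart (↥ s)
  pos = posPart (↥ s)
  dv>0 : ℚ.Positive (ι d ℚ.* ι v)
  dv>0 = subst ℚ.Positive (sym (ι-* d v)) (ι-positive (*-mono-≤ {1} {d} (s≤s z≤n) 0<v))
  left : (s ℚ.+ a) ℚ.* (ι d ℚ.* ι v) ℚ.+ ι neg ℚ.* ι v ≡ ι (pos * v + u * d)
  left = begin
    (s ℚ.+ a) ℚ.* (ι d ℚ.* ι v) ℚ.+ ι neg ℚ.* ι v
      ≡⟨ solve 5 (λ s a d v n → (s :+ a) :* (d :* v) :+ n :* v := (s :* d :+ n) :* v :+ (a :* v) :* d) refl s a (ι d) (ι v) (ι neg) ⟩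
    (s ℚ.* ι d ℚ.+ ι neg) ℚ.* ι v ℚ.+ (a ℚ.* ι v) ℚ.* ι d
      ≡⟨ cong₂ (λ x y → x ℚ.* ι v ℚ.+ y ℚ.* ι d) (signed-numerator s) av≡u ⟩
    ι pos ℚ.* ι v ℚ.+ ι u ℚ.* ι d
      ≡⟨ trans (cong₂ ℚ._+_ (ι-* pos v) (ι-* u d)) (ι-+ (pos * v) (u * d)) ⟩
    ι (pos * v + u * d) ∎
    where open ≡-Reasoning
          open import Data.Rational.Solver using (module +-*-Solver)
          open +-*-Solver
  right : 1ℚ ℚ.* (ι d ℚ.* ι v) ℚ.+ ι neg ℚ.* ι v ≡ ι (d * v + neg * v)
  right = trans (cong₂ ℚ._+_ (trans (ℚ.*-identityˡ _) (ι-* d v)) (ι-* neg v)) (ι-+ (d * v) (neg * v))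

module PartII (ε : Cut) (ε-real : IsReal ε) (0<ε : fromℕ 0 <ʳ ε) where

  Uε-pos : ∀ {b} → U ε b → 0ℚ ℚ.< b
  Uε-pos Ub = let q , 0<q , Lq = 0<ε in ℚ.<-trans 0<q (L<U ε-real Lq Ub)

  -- m ≤ r ^ (a l) for a rational a below ε. The a obtained from this side must serve for the other
  -- side too, where it gives 1 - ε < 1 - a.
  Small : ℕ → ℕ → ℕ → Set
  Small r l m = m ≡ 0 ⊎ ∃[ a ] ∃[ u ] (L ε a × Frac a u (↧ₙ a) × m ^ ↧ₙ a ≤ r ^ (u * l))

  -- The cuts yield n < 2 ^ p, p < r ^ s and s < 1 - ε < 1 - a; for p > 0, t is the integer part of
  -- p.
  n-bound : ∀ {r} .{{_ : NonZero r}} n {a u} → L ε a → Frac a u (↧ₙ a) → L (2 ^ʳ (r ^ʳ (fromℕ 1 -ʳ ε))) (ι n) →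
    ∃[ t ] (t ^ ↧ₙ a * r ^ u ≤ r ^ ↧ₙ a × n < 2 ^ suc t)
  n-bound {r} n {a} {u} La fa (p , (s , (a₁ , d , a₁<1 , Ud , s≡a₁-d) , p<r^s) , lt) = cases (0ℚ ℚ.<? p)
    where
    y v : ℕ
    y = ↧ₙ p
    v = ↧ₙ a
    s+a<1 : s ℚ.+ a ℚ.< 1ℚ
    s+a<1 = begin-strict
      s ℚ.+ a                <⟨ ℚ.+-monoʳ-< s (L<U ε-real La Ud) ⟩
      s ℚ.+ d                ≡⟨ cong (ℚ._+ d) s≡a₁-d ⟩
      a₁ ℚ.- d ℚ.+ d         ≡⟨ trans (ℚ.+-assoc a₁ (ℚ.- d) d) (trans (cong (a₁ ℚ.+_) (ℚ.+-inverseˡ d)) (ℚ.+-identityʳ a₁)) ⟩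
      a₁                     <⟨ a₁<1 ⟩
      1ℚ                     ∎
      where open ℚ.≤-Reasoning
    module _ {x} (fp : Frac p x y) where
      open ≤-Reasoning
      t^v*r^u≤ : (x / y) ^ v * r ^ u ≤ r ^ v
      t^v*r^u≤ = *-cancelʳ-≤ _ _ (y ^ v) {{m^n≢0 y v}} (begin
        (x / y) ^ v * r ^ u * y ^ v        ≡⟨ xy*z≡xz*y ((x / y) ^ v) (r ^ u) (y ^ v) ⟩
        (x / y) ^ v * y ^ v * r ^ u        ≡⟨ cong (_* r ^ u) (sym ([m*n]^o (x / y) y v)) ⟩
        (x / y * y) ^ v * r ^ u            ≤⟨ *-monoˡ-≤ (r ^ u) (^-monoˡ-≤ v (m/n*n≤m x y)) ⟩
        x ^ v * r ^ u                      ≤⟨ complement-power r x y (↧ₙ s) (posPart (↥ s)) (negPart (↥ s)) u v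
                                                (<⇒≤ (below {r} {p} fp s p<r^s)) (<⇒≤ (s+a<1⇒ {s} fa s+a<1)) ⟩
        r ^ v * y ^ v                      ∎)
      n< : n ^ y < 2 ^ x → n < 2 ^ suc (x / y)
      n< nʸ< = ^-cancelʳ-< y (begin-strict
        n ^ y                        <⟨ nʸ< ⟩
        2 ^ x                        ≤⟨ ^-monoʳ-≤ 2 (begin
          x                            ≡⟨ m≡m%n+[m/n]*n x y ⟩
          x % y + x / y * y            ≤⟨ +-monoˡ-≤ (x / y * y) (<⇒≤ (m%n<n x y)) ⟩
          suc (x / y) * y              ∎) ⟩
        2 ^ (suc (x / y) * y)        ≡⟨ sym (^-*-assoc 2 (suc (x / y)) y) ⟩
        (2 ^ suc (x / y)) ^ y        ∎)
    cases : Dec (0ℚ ℚ.< p) → ∃[ t ] (t ^ v * r ^ u ≤ r ^ v × n < 2 ^ suc t)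
    cases (no p≯0)  = 0 , z≤n , subst (_< 2) (sym (below⁰-ℕ {2} {n} p p≯0 lt)) z<s
    cases (yes 0<p) = let x , fp , nʸ< = below⁺-ℕ {2} {n} p 0<p lt in x / y , t^v*r^u≤ fp , n< fp nʸ<

  module _ {r l : ℕ} .{{_ : NonZero r}} (2≤r : 2 ≤ r) (r≤2^l : r ≤ 2 ^ l) where

    private
      log-pos : ∀ {b} → U (log (fromℕ r)) b → 0ℚ ℚ.< b
      log-pos = U-log-pos {fromℕ r} (ℚ.<-trans (ι-mono-< {1} {r} 2≤r))

    m-bound : ∀ m → L (2 ^ʳ (ε *ʳ (log (fromℕ r) ^ⁿ 2))) (ι m) → Small r l m
    m-bound m (p , Lp , lt) = cases (0ℚ ℚ.<? p)
      where
      cases : Dec (0ℚ ℚ.< p) → Small r l m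
      cases (no p≯0)  = inj₁ (below⁰-ℕ {2} {m} p p≯0 lt)
      cases (yes 0<p) =
        let np , fp , mᵈ<                           = below⁺-ℕ {2} {m} p 0<p lt
            a , c , 0<a , 0<c , La , Lc , p<ac        = L-*-pos {ε} {log (fromℕ r) ^ⁿ 2} {p} Lp (ℚ.<⇒≤ 0<p) Uε-pos
            a₂ , c₂ , 0<a₂ , 0<c₂ , La₂ , Lc₂ , c<a₂c₂ = L-*-pos {log (fromℕ r)} {log (fromℕ r) ^ⁿ 1} {c} Lc (ℚ.<⇒≤ 0<c) log-pos
            a₃ , c₃ , 0<a₃ , 0<c₃ , La₃ , c₃<1 , c₂<a₃c₃ = L-*-pos {log (fromℕ r)} {log (fromℕ r) ^ⁿ 0} {c₂} Lc₂ (ℚ.<⇒≤ 0<c₂) log-pos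
            u , fa        = frac-pos 0<a
            n₂ , f₂ , lt₂ = L-log {fromℕ r} {a₂} r 0<a₂ (λ q<r → q<r) La₂
            n₃ , f₃ , lt₃ = L-log {fromℕ r} {a₃} r 0<a₃ (λ q<r → q<r) La₃
        in inj₂ (a , u , La , fa ,
          log²-power {r} {l} r≤2^l m np (↧ₙ p) u (↧ₙ a) n₂ (↧ₙ a₂) n₃ (↧ₙ a₃) (<⇒≤ mᵈ<)
            (<⇒≤ (frac-< fp (frac-* fa (frac-* f₂ f₃)) (p<a[a₂a₃] 0<a 0<a₂ 0<a₃ p<ac c<a₂c₂ c₂<a₃c₃ c₃<1)))
            (<⇒≤ lt₂) lt₃)
        where
        p<a[a₂a₃] : ∀ {a c a₂ c₂ a₃ c₃} → 0ℚ ℚ.< a → 0ℚ ℚ.< a₂ → 0ℚ ℚ.< a₃ →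
          p ℚ.< a ℚ.* c → c ℚ.< a₂ ℚ.* c₂ → c₂ ℚ.< a₃ ℚ.* c₃ → c₃ ℚ.< 1ℚ → p ℚ.< a ℚ.* (a₂ ℚ.* a₃)
        p<a[a₂a₃] {a} {c} {a₂} {c₂} {a₃} {c₃} 0<a 0<a₂ 0<a₃ p<ac c<a₂c₂ c₂<a₃c₃ c₃<1 = begin-strict
          p                             <⟨ p<ac ⟩
          a ℚ.* c                       <⟨ ℚ.*-monoʳ-<-pos a {{ℚ.positive 0<a}} (begin-strict
            c                             <⟨ c<a₂c₂ ⟩
            a₂ ℚ.* c₂                     <⟨ ℚ.*-monoʳ-<-pos a₂ {{ℚ.positive 0<a₂}} (begin-strict
              c₂                            <⟨ c₂<a₃c₃ ⟩
              a₃ ℚ.* c₃                     <⟨ ℚ.*-monoʳ-<-pos a₃ {{ℚ.positive 0<a₃}} c₃<1 ⟩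
              a₃ ℚ.* 1ℚ                     ≡⟨ ℚ.*-identityʳ a₃ ⟩
              a₃                            ∎) ⟩
            a₂ ℚ.* a₃                     ∎) ⟩
          a ℚ.* (a₂ ℚ.* a₃)             ∎
          where open ℚ.≤-Reasoning

  theorem : ForLarge (λ r → g⌊ 2 ^ʳ (ε *ʳ (log (fromℕ r) ^ⁿ 2)) , 2 ^ʳ (r ^ʳ (fromℕ 1 -ʳ ε)) ⌋≤ r)
  -- 256 = 2⁸ makes l + 1 exceed 8, as `code-bound₂` requires.
  theorem = 256 , large
    where
    n<2^n : ∀ n → n < 2 ^ n
    n<2^n zero    = z<s
    n<2^n (suc n) = ≤-trans (+-mono-≤ (m^n>0 2 n) (n<2^n n)) (≤-reflexive (cong (λ x → 2 ^ n + x) (sym (+-identityʳ _))))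

    large : ∀ r → 256 ≤ r → g⌊ 2 ^ʳ (ε *ʳ (log (fromℕ r) ^ⁿ 2)) , 2 ^ʳ (r ^ʳ (fromℕ 1 -ʳ ε)) ⌋≤ r
    large r@(suc _) 256≤r m n m-floor n-floor =
      let l , 2^l≤r , r<2^1+l = binary-length r
          m′ , m≤1+m′ , Lm    = floor-pred {m} {2 ^ʳ (ε *ʳ (log (fromℕ r) ^ⁿ 2))} m-floor
          n′ , n≤1+n′ , Ln    = floor-pred {n} {2 ^ʳ (r ^ʳ (fromℕ 1 -ʳ ε))} n-floor
      in colorable⇒g≤ (colorable {l} {m′} {n′} 2^l≤r r<2^1+l m≤1+m′ n≤1+n′ Ln
        (≡0⊎ (Small r (suc l)) (inj₁ refl) (m-bound {r} {suc l} 2≤r (<⇒≤ r<2^1+l) m′) Lm))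
      where
      2≤r : 2 ≤ r
      2≤r = ≤-trans (s≤s (s≤s z≤n)) 256≤r
      module _ {l m′ n′} (2^l≤r : 2 ^ l ≤ r) (r<2^1+l : r < 2 ^ suc l) (m≤1+m′ : m ≤ suc m′) (n≤1+n′ : n ≤ suc n′)
        (Ln : n′ ≡ 0 ⊎ L (2 ^ʳ (r ^ʳ (fromℕ 1 -ʳ ε))) (ι n′)) where
        8<1+l : 8 < suc l
        8<1+l = ≰⇒> λ 1+l≤8 → <⇒≱ r<2^1+l (≤-trans (^-monoʳ-≤ 2 1+l≤8) 256≤r)
        colorable : Small r (suc l) m′ → Colorable m n r
        -- Here m ≤ 1 and no a is at hand; but a single word has no conflicts, so the length n can
        -- be afforded.
        colorable (inj₁ m′≡0) = code-colorable r n l 0 m n 2^l≤r (subst (λ k → m ≤ suc k) m′≡0 m≤1+m′) (<⇒≤ (n<2^n n))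
          (inj₂ (m^n>0 (r * suc l) (suc l)))
        colorable (inj₂ (a , u , La , fa , m′ᵛ≤)) =
          let t , tᵛ≤ , n′<2^1+t = ≡0⊎ (λ n → ∃[ t ] (t ^ ↧ₙ a * r ^ u ≤ r ^ ↧ₙ a × n < 2 ^ suc t)) (0 , z≤n , z<s)
                (n-bound {r} n′ La fa) Ln
          in code-colorable r (suc t) l m′ m n 2^l≤r m≤1+m′ (≤-trans n≤1+n′ n′<2^1+t)
            (code-bound₂ r t (suc l) m′ u (↧ₙ a) 8<1+l m′ᵛ≤ tᵛ≤)

module PartIII where

  -- 1/32 is half of the 1/16 in 16 m ≤ r²; the half pays for the step from m′ to m′ + 1. 1/64
  -- merely witnesses that c is positive.
  1/32 1/64 : ℚ
  1/32 = ℤ.+ 1 ℚ./ 32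
  1/64 = ℤ.+ 1 ℚ./ 64

  frac-1/32 : Frac 1/32 1 32
  frac-1/32 = frac z<s refl

  0<1/32 : 0ℚ ℚ.< 1/32
  0<1/32 = toWitness {a? = 0ℚ ℚ.<? 1/32} _

  module _ {r : ℕ} .{{_ : NonZero r}} where
    private
      E : ℕ
      E = r * r

    m-bound : ∀ m → L (fromℚ 1/32 *ʳ fromℕ (r * r)) (ι m) → 32 * m < r * r
    m-bound m Lm =
      let a , c , 0<a , 0<c , a<1/32 , c<E , m<ac = L-*-pos {fromℚ 1/32} {fromℕ E} {ι m} Lm (0≤ι m) (ℚ.<-trans 0<1/32)
      in subst₂ _<_ (*-comm m 32) (trans (*-identityʳ _) (*-identityˡ E))
        (frac-< (frac-ι m) (frac-* frac-1/32 (frac-ι E)) (ℚ.<-trans m<ac (*-mono-<-pos 0<1/32 0<c a<1/32 c<E)))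

    numerator-bound : ∀ {a x} → Frac a x (↧ₙ a) → L (r ^ʳ (fromℕ E /ʳ fromℕ 2)) a →
      x * x ≤ r ^ E * (↧ₙ a * ↧ₙ a)
    numerator-bound {a} {x} fa (p , Lp , lt) = cases (0ℚ ℚ.<? p)
      where
      cases : Dec (0ℚ ℚ.< p) → x * x ≤ r ^ E * (↧ₙ a * ↧ₙ a)
      cases (no p≯0)  = let x<y = below⁰ {r} {a} p (ℚ.≮⇒≥ p≯0) fa lt in
        ≤-trans (*-mono-≤ (<⇒≤ x<y) (<⇒≤ x<y)) (m≤n*m (↧ₙ a * ↧ₙ a) (r ^ E) {{m^n≢0 r E}})
      cases (yes 0<p) =
        let np , fp , low         = below⁺ p 0<p
            b , 0<b , b<E , p*2<b = L-/-pos {fromℕ E} {fromℕ 2} {p} {ι 2} (0<ι 2) (ℚ.<⇒≤ 0<p) (U-fromℕ-pos E) (λ 2<u → 2<u) Lp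
        in square-≤ x (↧ₙ a) r E (↧ₙ p) np (<⇒≤ (low {r} {a} fa lt))
          (<⇒≤ (subst₂ _<_ (*-identityʳ _) (cong (E *_) (*-identityʳ (↧ₙ p)))
            (frac-< (frac-* fp (frac-ι 2)) (frac-ι E) (ℚ.<-trans p*2<b b<E))))

    n-bound : ∀ n → L ((r ^ʳ (fromℕ (r * r) /ʳ fromℕ 2)) /ʳ (e ^ⁿ (r * r))) (ι n) →
      n * n * 25 ^ (r * r) ≤ 4 ^ (r * r) * r ^ (r * r)
    n-bound n Ln =
      let a , c , 0<a , 0<c , La , Lc , n<ac =
            L-*-pos {r ^ʳ (fromℕ E /ʳ fromℕ 2)} {inv (e ^ⁿ E)} {ι n} Ln (0≤ι n) (λ (_ , _ , 0<b , _) → 0<b)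
          xa , fa = frac-pos 0<a
          xc , fc = frac-pos 0<c
      in random-small n xa (↧ₙ a) xc (↧ₙ c) r E
        (<⇒≤ (subst (n * (↧ₙ a * ↧ₙ c) <_) (*-identityʳ _) (frac-< (frac-ι n) (frac-* fa fc) n<ac)))
        (numerator-bound fa La)
        (<⇒≤ (subst₂ _<_ (*-identityʳ _) (*-identityˡ _)
          (frac-< (frac-* fc (frac-^ frac-5/2 E)) (frac-ι 1) (L-inv {e ^ⁿ E} 0<c Lc ([5/2]^k<U-e^k E)))))

  theorem : Σ Cut (λ c → IsReal c × fromℕ 0 <ʳ c ×
    ForLarge (λ r →
      g⌊ c *ʳ fromℕ (r * r) , (r ^ʳ (fromℕ (r * r) /ʳ fromℕ 2)) /ʳ (e ^ⁿ (r * r)) ⌋≤ r))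
  theorem = fromℚ 1/32 , isReal-fromℚ 1/32
    , (1/64 , toWitness {a? = 0ℚ ℚ.<? 1/64} _ , toWitness {a? = 1/64 ℚ.<? 1/32} _)
    , 4 , large
    where
    large : ∀ r → 4 ≤ r →
      g⌊ fromℚ 1/32 *ʳ fromℕ (r * r) , (r ^ʳ (fromℕ (r * r) /ʳ fromℕ 2)) /ʳ (e ^ⁿ (r * r)) ⌋≤ r
    large r@(suc _) 4≤r m n m-floor n-floor =
      let m′ , m≤1+m′ , Lm = floor-pred {m} {fromℚ 1/32 *ʳ fromℕ (r * r)} m-floor
          n′ , n≤1+n′ , Ln = floor-pred {n} {(r ^ʳ (fromℕ (r * r) /ʳ fromℕ 2)) /ʳ (e ^ⁿ (r * r))} n-floor
      in colorable⇒g≤ (random-colorable r m n n′ 4≤r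
        (16m≤r² m′ m≤1+m′ (≡0⊎ (λ m → 32 * m ≤ r * r) z≤n (λ Lm → <⇒≤ (m-bound {r} m′ Lm)) Lm)) n≤1+n′
        (≡0⊎ (λ n → n * n * 25 ^ (r * r) ≤ 4 ^ (r * r) * r ^ (r * r)) z≤n (n-bound {r} n′) Ln))
      where
      16m≤r² : ∀ m′ → m ≤ suc m′ → 32 * m′ ≤ r * r → 16 * m ≤ r * r
      16m≤r² zero     m≤1 _      = ≤-trans (*-monoʳ-≤ 16 m≤1) (*-mono-≤ 4≤r 4≤r)
      16m≤r² (suc m′) m≤  32m′≤  = begin
        16 * m                ≤⟨ *-monoʳ-≤ 16 (≤-trans m≤ (s≤s (s≤s (m≤m+n m′ m′)))) ⟩
        16 * (2 + (m′ + m′))  ≡⟨ e₁ m′ ⟩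
        32 * suc m′           ≤⟨ 32m′≤ ⟩
        r * r                 ∎
        where
        open ≤-Reasoning
        e₁ : ∀ m → 16 * (2 + (m + m)) ≡ 32 * suc m
        e₁ = solve-∀

theorem1p3 : ((C : Cut) → IsReal C → (e ^ⁿ 2) <ʳ C →
    ForLarge (λ r →
    g⌊ r ^ʳ (log C /ʳ fromℕ 2) , r ^ʳ (fromℕ r /ʳ (fromℕ 2 *ʳ C)) ⌋≤ r))
    ×
    ((ε : Cut) → IsReal ε → fromℕ 0 <ʳ ε →
    ForLarge (λ r →
    g⌊ 2 ^ʳ (ε *ʳ (log (fromℕ r) ^ⁿ 2)) , 2 ^ʳ (r ^ʳ (fromℕ 1 -ʳ ε)) ⌋≤ r))
    ×
    Σ Cut (λ c → IsReal c × fromℕ 0 <ʳ c ×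
    ForLarge (λ r →
    g⌊ c *ʳ fromℕ (r * r) , (r ^ʳ (fromℕ (r * r) /ʳ fromℕ 2)) /ʳ (e ^ⁿ (r * r)) ⌋≤ r))
theorem1p3 = PartI.theorem , PartII.theorem , PartIII.theorem
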